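{- Let $G=(V,E)$ be a finite undirected graph (loops and multiple edges allowed), and let $W\subseteq V$ with $V\backslash W=\{v_1,v_2,\dots,v_n\}$ (distinct vertices). Then the number of bases of the matroid $\mathrm{TM}(G,W)$ is equal to $$\sum_{(a_1,a_2,\dots,a_n)\in D^+(G[V\backslash W])}\ \prod_{i=1}^n\binom{\deg_G(v_i)}{a_i},$$ where $G[V\backslash W]$ is the induced subgraph of $G$ on $V\backslash W$.
   Context: Degree: $\deg_G(v)$ is the number of edges of $G$ incident to $v$, where a loop at $v$ contributes $2$. Labelings: let $\infty$ be a symbol with $\infty\notin V$, and let $\alpha=(m(v),\,v\in V)$ be a vector of non-negative integers. A labeling of $G$ with respect to $\alpha$ is a map $\varphi:E\to V\cup\{\infty\}$ such that (i) for every $e\in E$ with ends $v$ and $w$, $\varphi(e)\in\{v,w,\infty\}$; and (ii) $|\varphi^{ -1}(v)|\leq m(v)$ for each $v\in V$. Its height is $\mathrm{Hei}(\varphi):=|\{e\in E\mid \varphi(e)\neq\infty\}|$. The matroid $\mathrm{TM}(G)$: let $S_G:=\{(v,i)\in V\times\mathbb{N}\mid 1\leq i\leq\deg_G(v)\}$. For $X\subseteq S_G$ let $\alpha(X):=(m_X(v),\,v\in V)$ with $m_X(v):=|\{i\mid (v,i)\in X\}|$, and let $r_G(X)$ be the maximum of $\mathrm{Hei}(\varphi)$ over all labelings $\varphi$ of $G$ with respect to $\alpha(X)$. The function $r_G$ is the rank function of a matroid on $S_G$, and $\mathrm{TM}(G)$ denotes this matroid. The matroid $\mathrm{TM}(G,W)$: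 for $W\subseteq V$, let $S_G(W):=\{(v,i)\in W\times\mathbb{N}\mid 1\leq i\leq\deg_G(v)\}$. Then $\mathrm{TM}(G,W):=\mathrm{TM}(G)\backslash S_G(W)$ (matroid deletion). Orientations: an orientation $\mathcal{O}$ of a graph $H$ assigns a direction to each edge of $H$; the out-degree $\deg^+_{\mathcal{O}}(v)$ is the number of arcs with tail $v$ (a directed loop at $v$ has tail $v$ and head $v$, so counts once). For a graph $H$ with vertices $v_1,\dots,v_n$, two orientations are equivalent if they have the same out-degree vector $(\deg^+_{\mathcal{O}}(v_1),\dots,\deg^+_{\mathcal{O}}(v_n))$. $D^+(H)$ is the set of equivalence classes, each identified with its common out-degree vector; thus $D^+(H)$ is the set of distinct out-degree vectors of orientations of $H$. -}

module Defs where

open import Data.Bool using (Bool; true; false; if_then_else_)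
import Data.Bool as Bool
open import Data.Fin using (Fin; zero; suc; _≟_)
open import Data.Fin.Properties using (all?; any?)
open import Data.Fin.Subset
  using (Subset; inside; outside; ⊤; _⊆_; _∩_; _∪_; _─_; ∣_∣)
open import Data.Fin.Subset.Properties using
  (_⊆?_; anySubset?; ⊆-trans; p─q⊆p; p∩q⊆p; p∩q⊆q; p⊆p∪q; p⊆q⇒∣p∣≤∣q∣; x∈p∩q⁺; x∈p∩q⁻)
open import Data.List using
  (List; []; _∷_; map; concatMap; mapMaybe; filter; deduplicate;
   length; allFin; applyUpTo; cartesianProductWith)
import Data.List as List
open import Data.List.Extrema.Nat using (max; v≤max⁺; argmax-sel)
open import Data.List.Membership.Propositional using (_∈_; lose)
open import Data.List.Membership.Propositional.Properties
  using (∈-cartesianProductWith⁺; ∈-filter⁺; ∈-filter⁻; ∈-map⁺; ∈-map⁻; ∈-allFin)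
open import Data.List.Relation.Unary.Any using (here; there)
open import Data.Maybe using (Maybe; just; nothing; zip)
import Data.Maybe as Maybe
open import Data.Maybe.Properties using () renaming (≡-dec to maybe-≡-dec)
open import Data.Nat using (ℕ; zero; suc; _+_; _∸_; _≤_; _<_; _≤?_; z≤n; s≤s)
import Data.Nat as ℕ
open import Data.Nat.Properties hiding (_≟_; _≤?_)
open import Data.Product using (∃; _×_; _,_; proj₁; proj₂)
open import Data.Sum using (_⊎_; inj₁; inj₂)
open import Data.Vec using (Vec; []; _∷_; count; fromList; zipWith)
import Data.Vec as Vec
open import Data.Vec.Properties using (≡-dec)
open import Function using (_∘_)
open import Relation.Binary.PropositionalEquality
  using (_≡_; _≢_; refl; sym; trans; cong; cong₂; subst₂)
open import Relation.Nullary using (Dec; yes; no; ¬?; does; contradiction)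
open import Relation.Nullary.Decidable using (map′; _×-dec_; _⊎-dec_; dec⇒maybe; decidable-stable)
open import Relation.Unary using (Decidable)

words : ∀ {A : Set} → List A → ∀ n → List (Vec A n)
words xs zero    = [] ∷ []
words xs (suc n) = cartesianProductWith _∷_ xs (words xs n)

∈-words : ∀ {A : Set} {xs : List A} → (∀ x → x ∈ xs) → ∀ {n} (w : Vec A n) → w ∈ words xs n
∈-words all []      = here refl
∈-words all (x ∷ w) = ∈-cartesianProductWith⁺ _∷_ (all x) (∈-words all w)

subsets : ∀ n → List (Subset n)
subsets = words (outside ∷ inside ∷ [])

-- The ground set is a subset of Fin n, so that deletion need not renumber the
-- elements. Only the values of the rank function on subsets of the ground set
-- are meaningful.
record Matroid (n : ℕ) : Set where
  field
    ground          : Subset n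
    rank            : Subset n → ℕ
    rank-≤-size     : ∀ {X} → X ⊆ ground → rank X ≤ ∣ X ∣
    rank-mono       : ∀ {X Y} → X ⊆ Y → Y ⊆ ground → rank X ≤ rank Y
    rank-submodular : ∀ {X Y} → X ⊆ ground → Y ⊆ ground →
                      rank (X ∪ Y) + rank (X ∩ Y) ≤ rank X + rank Y

  Independent : Subset n → Set
  Independent X = X ⊆ ground × rank X ≡ ∣ X ∣

  independent? : Decidable Independent
  independent? X = (X ⊆? ground) ×-dec (rank X ℕ.≟ ∣ X ∣)

  IsBasis : Subset n → Set
  IsBasis B = Independent B × (∀ X → Independent X → B ⊆ X → X ≡ B)

  isBasis? : Decidable IsBasis
  isBasis? B = independent? B ×-dec map′
    (λ none X ind B⊆X → decidable-stable (≡B? X) λ X≢B → none (X , ind , (λ {_} → B⊆X) , X≢B))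
    (λ { maximal (X , ind , B⊆X , X≢B) → X≢B (maximal X ind B⊆X) })
    (¬? (anySubset? λ X → independent? X ×-dec ((B ⊆? X) ×-dec ¬? (≡B? X))))
    where
    ≡B? : ∀ X → Dec (X ≡ B)
    ≡B? X = ≡-dec Bool._≟_ X B

  numberOfBases : ℕ
  numberOfBases = length (filter isBasis? (subsets n))

infixl 5 _∖_
_∖_ : ∀ {n} → Matroid n → Subset n → Matroid n
_∖_ M T = record
  { ground          = ground ─ T
  ; rank            = rank
  ; rank-≤-size     = λ X⊆ → rank-≤-size (shrink X⊆)
  ; rank-mono       = λ X⊆Y Y⊆ → rank-mono X⊆Y (shrink Y⊆)
  ; rank-submodular = λ X⊆ Y⊆ → rank-submodular (shrink X⊆) (shrink Y⊆)
  }
  where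
  open Matroid M
  shrink : ∀ {X} → X ⊆ ground ─ T → X ⊆ ground
  shrink X⊆ = ⊆-trans X⊆ (p─q⊆p ground T)

-- A finite multigraph: the vertices are Fin order and the edges are the
-- positions in the list. Which end of an edge is listed first is immaterial; a
-- loop lists its vertex twice.
record Graph : Set where
  constructor graph
  field
    order : ℕ
    edges : List (Fin order × Fin order)

  Vertex : Set
  Vertex = Fin order

  size : ℕ
  size = length edges

open Graph public using (Vertex)

ends : ∀ {A : Set} → A × A → List A
ends (a , b) = a ∷ b ∷ []

deg : (G : Graph) → Vertex G → ℕ
deg G v = length (filter (v ≟_) (concatMap ends (Graph.edges G)))

-- Labels are Maybe V, with nothing in the role of ∞. Edge lists stand for
-- graphs on a fixed vertex set so that proofs can recurse on the edges.
module _ {p : ℕ} where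

  private
    V : Set
    V = Fin p

  Labels : List (V × V) → Set
  Labels es = Vec (Maybe V) (length es)

  Allowed : V × V → Maybe V → Set
  Allowed (v , w) l = l ≡ just v ⊎ l ≡ just w ⊎ l ≡ nothing

  _≟ₗ_ : (k l : Maybe V) → Dec (k ≡ l)
  _≟ₗ_ = maybe-≡-dec _≟_

  fibre : ∀ {q} → Vec (Maybe V) q → V → ℕ
  fibre φ v = count (_≟ₗ just v) φ

  height : ∀ {q} → Vec (Maybe V) q → ℕ
  height = count (λ l → ¬? (l ≟ₗ nothing))

  IsLabeling : (es : List (V × V)) → (V → ℕ) → Labels es → Set
  IsLabeling es m φ =
    (∀ e → Allowed (List.lookup es e) (Vec.lookup φ e)) × (∀ v → fibre φ v ≤ m v)

  isLabeling? : ∀ es m → Decidable (IsLabeling es m)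
  isLabeling? es m φ =
    all? (λ e → let (v , w) = List.lookup es e ; l = Vec.lookup φ e in
                (l ≟ₗ just v) ⊎-dec ((l ≟ₗ just w) ⊎-dec (l ≟ₗ nothing)))
    ×-dec all? (λ v → fibre φ v ≤? m v)

  labels : List (Maybe V)
  labels = nothing ∷ map just (allFin p)

  labelings : (es : List (V × V)) → (V → ℕ) → List (Labels es)
  labelings es m = filter (isLabeling? es m) (words labels (length es))

  -- The default 0 is harmless: it is the height of the labeling constantly ∞.
  maxHeight : List (V × V) → (V → ℕ) → ℕ
  maxHeight es m = max 0 (map height (labelings es m))

  ∈-labels : ∀ l → l ∈ labels
  ∈-labels nothing  = here refl
  ∈-labels (just v) = there (∈-map⁺ just (∈-allFin v))

  maxHeight-upper : ∀ es m φ → IsLabeling es m φ → height φ ≤ maxHeight es m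
  maxHeight-upper es m φ lab = v≤max⁺ 0 _ (inj₂ (lose
    (∈-map⁺ height (∈-filter⁺ (isLabeling? es m) (∈-words ∈-labels φ) lab)) ≤-refl))

  const∞ : ∀ es m → ∃ λ φ → IsLabeling es m φ × height φ ≡ 0
  const∞ []       m = [] , ((λ ()) , λ _ → z≤n) , refl
  const∞ (e ∷ es) m with const∞ es m
  ... | φ , (ok , φ≤m) , h≡0 =
    nothing ∷ φ , ((λ { zero → inj₂ (inj₂ refl) ; (suc i) → ok i }) , φ≤m) , h≡0

  maxHeight-attained : ∀ es m → ∃ λ φ → IsLabeling es m φ × maxHeight es m ≡ height φ
  maxHeight-attained es m with argmax-sel (λ x → x) 0 (map height (labelings es m))
  ... | inj₁ max≡0 with const∞ es m
  ...   | φ , lab , h≡0 = φ , lab , trans max≡0 (sym h≡0)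
  maxHeight-attained es m | inj₂ max∈ with ∈-map⁻ height max∈
  ...   | φ , φ∈ , max≡h =
    φ , proj₂ (∈-filter⁻ (isLabeling? es m) {xs = words labels (length es)} φ∈) , max≡h

  -- m_X(v), where f sends each element of the ground set to its vertex.
  mult : ∀ {n} → (Fin n → V) → Subset n → V → ℕ
  mult f X v = ∣ X ∩ Vec.tabulate (λ k → does (f k ≟ v)) ∣

  private
    Mult : Set
    Mult = V → ℕ

    infix 4 _≼_
    _≼_ : Mult → Mult → Set
    m ≼ k = ∀ v → m v ≤ k v

    δ : V → Mult
    δ c v = if does (c ≟ v) then 1 else 0

    infixl 6 _⊕_ _⊖_
    _⊕_ _⊖_ : Mult → Mult → Mult
    (m ⊕ k) v = m v + k v
    (m ⊖ k) v = m v ∸ k v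

    δ-≢ : ∀ {c v} → c ≢ v → δ c v ≡ 0
    δ-≢ {c} {v} c≢v with c ≟ v
    ... | yes c≡v = contradiction c≡v c≢v
    ... | no _    = refl

    δ≼ : ∀ c m → 0 < m c → δ c ≼ m
    δ≼ c m 0<m v with c ≟ v
    ... | yes refl = 0<m
    ... | no _     = z≤n

    δ≼⁻¹ : ∀ {c m} → δ c ≼ m → 0 < m c
    δ≼⁻¹ {c} h with c ≟ c | h c
    ... | yes _  | p = p
    ... | no c≢c | _ = contradiction refl c≢c

    fibre-just : ∀ {q} c (φ : Vec (Maybe V) q) v → fibre (just c ∷ φ) v ≡ δ c v + fibre φ v
    fibre-just c φ v with c ≟ v
    ... | yes _ = refl
    ... | no _  = refl

    maxHeight-mono : ∀ es {m k} → m ≼ k → maxHeight es m ≤ maxHeight es k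
    maxHeight-mono es {m} {k} m≼k with maxHeight-attained es m
    ... | φ , (ok , φ≤m) , eq = ≤-trans (≤-reflexive eq)
      (maxHeight-upper es k φ (ok , λ v → ≤-trans (φ≤m v) (m≼k v)))

    -- An optimal labeling either leaves the first edge at ∞ or spends one unit
    -- of the multiplicity of one of its ends.
    module FirstEdge (e : V × V) (es : List (V × V)) where

      ρ ρ⁺ : Mult → ℕ
      ρ  = maxHeight es
      ρ⁺ = maxHeight (e ∷ es)

      End : V → Set
      End c = Allowed e (just c)

      skip : ∀ {m} → ρ m ≤ ρ⁺ m
      skip {m} with maxHeight-attained es m
      ... | φ , (ok , φ≤m) , eq = ≤-trans (≤-reflexive eq)
        (maxHeight-upper (e ∷ es) m (nothing ∷ φ)
          ((λ { zero → inj₂ (inj₂ refl) ; (suc k) → ok k }) , φ≤m))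

      use : ∀ {c} {m} → End c → 0 < m c → suc (ρ (m ⊖ δ c)) ≤ ρ⁺ m
      use {c} {m} end 0<m with maxHeight-attained es (m ⊖ δ c)
      ... | φ , (ok , φ≤m) , eq = ≤-trans (s≤s (≤-reflexive eq))
        (maxHeight-upper (e ∷ es) m (just c ∷ φ)
          ( (λ { zero → end ; (suc j) → ok j })
          , λ v → ≤-trans (≤-reflexive (fibre-just c φ v)) (≤-trans (+-monoʳ-≤ (δ c v) (φ≤m v))
                    (≤-reflexive (m+[n∸m]≡n (δ≼ c m 0<m v))))))

      cases : ∀ m → ρ⁺ m ≤ ρ m ⊎ (∃ λ c → End c × 0 < m c × ρ⁺ m ≤ suc (ρ (m ⊖ δ c)))
      cases m with maxHeight-attained (e ∷ es) m
      ... | nothing ∷ φ , (ok , φ≤m) , eq =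
        inj₁ (≤-trans (≤-reflexive eq) (maxHeight-upper es m φ (ok ∘ suc , φ≤m)))
      ... | just c ∷ φ , (ok , φ≤m) , eq = inj₂
        (c , ok zero , δ≼⁻¹ (λ v → ≤-trans (m≤m+n _ _) (le v)) ,
          ≤-trans (≤-reflexive eq) (s≤s (maxHeight-upper es (m ⊖ δ c) φ
            (ok ∘ suc , λ v → m+n≤o⇒m≤o∸n (fibre φ v)
              (≤-trans (≤-reflexive (+-comm (fibre φ v) (δ c v))) (le v))))))
        where
        le : ∀ v → δ c v + fibre φ v ≤ m v
        le v = ≤-trans (≤-reflexive (sym (fibre-just c φ v))) (φ≤m v)

      ρ⁺≤1+ρ : ∀ m → ρ⁺ m ≤ suc (ρ m)
      ρ⁺≤1+ρ m with cases m
      ... | inj₁ h               = m≤n⇒m≤1+n h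
      ... | inj₂ (c , _ , _ , h) = ≤-trans h (s≤s (maxHeight-mono es λ v → m∸n≤m (m v) (δ c v)))

    maxHeight-unit : ∀ es c m {k} → k ≼ δ c ⊕ m → maxHeight es k ≤ suc (maxHeight es m)
    maxHeight-unit [] c m {k} _ with maxHeight-attained [] k
    ... | [] , _ , eq = ≤-trans (≤-reflexive eq) z≤n
    maxHeight-unit (e ∷ es) c m {k} k≼ with FirstEdge.cases e es k
    ... | inj₁ h = ≤-trans h (≤-trans (maxHeight-unit es c m k≼) (s≤s (FirstEdge.skip e es)))
    ... | inj₂ (a , end , 0<k , h) with c ≟ a
    ...   | yes refl = ≤-trans h (s≤s (≤-trans
              (maxHeight-mono es λ v → m≤n+o⇒m∸n≤o (k v) (δ c v) (k≼ v))
              (FirstEdge.skip e es)))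
    ...   | no c≢a = ≤-trans h (s≤s (≤-trans (maxHeight-unit es c (m ⊖ δ a) λ v →
              ≤-trans (∸-monoˡ-≤ (δ a v) (k≼ v)) (≤-reflexive (+-∸-assoc (δ c v) (δ≼ a m 0<m v))))
              (FirstEdge.use e es {a} {m} end 0<m)))
      where
      0<m : 0 < m a
      0<m = ≤-trans 0<k (≤-trans (k≼ a) (≤-reflexive (cong (_+ m a) (δ-≢ c≢a))))

    sub : ∀ d {z} m {x} y → d ≤ z → d ≤ x → z + m ≤ x + y → (z ∸ d) + m ≤ (x ∸ d) + y
    sub d m y d≤z d≤x h =
      subst₂ _≤_ (+-∸-comm m d≤z) (+-∸-comm y d≤x) (∸-monoˡ-≤ d h)

    swap : ∀ z m {x y} → z + m ≤ x + y → m + z ≤ y + x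
    swap z m {x} {y} = subst₂ _≤_ (+-comm z m) (+-comm x y)

    maxHeight-submodular : ∀ es {m x y z} → m ≼ x → m ≼ y → m ≼ z → z ⊕ m ≼ x ⊕ y →
      maxHeight es z + maxHeight es m ≤ maxHeight es x + maxHeight es y
    maxHeight-submodular [] {m} {z = z} _ _ _ _ with maxHeight-attained [] z | maxHeight-attained [] m
    ... | [] , _ , eq | [] , _ , eq′ = ≤-trans (≤-reflexive (cong₂ _+_ eq eq′)) z≤n
    maxHeight-submodular (e ∷ es) {m} {x} {y} {z} m≼x m≼y m≼z bal = result
      where
      open FirstEdge e es

      Goal : Set
      Goal = ρ⁺ z + ρ⁺ m ≤ ρ⁺ x + ρ⁺ y

      both : ∀ {c} → End c → 0 < m c → ρ⁺ z ≤ suc (ρ (z ⊖ δ c)) → ρ⁺ m ≤ suc (ρ (m ⊖ δ c)) → Goal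
      both {c} end 0<m hz hm = begin
        ρ⁺ z + ρ⁺ m                            ≤⟨ +-mono-≤ hz hm ⟩
        suc (ρ (z ⊖ δ c)) + suc (ρ (m ⊖ δ c))  ≡⟨ cong suc (+-suc _ _) ⟩
        2 + (ρ (z ⊖ δ c) + ρ (m ⊖ δ c))        ≤⟨ s≤s (s≤s ih) ⟩
        2 + (ρ (x ⊖ δ c) + ρ (y ⊖ δ c))        ≡⟨ cong suc (+-suc _ _) ⟨
        suc (ρ (x ⊖ δ c)) + suc (ρ (y ⊖ δ c))  ≤⟨ +-mono-≤ (use {m = x} end (≤-trans 0<m (m≼x c)))
                                                           (use {m = y} end (≤-trans 0<m (m≼y c))) ⟩
        ρ⁺ x + ρ⁺ y                            ∎
        where
        open ≤-Reasoning
        d≤m : δ c ≼ m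
        d≤m = δ≼ c m 0<m
        ih = maxHeight-submodular es
          (λ v → ∸-monoˡ-≤ (δ c v) (m≼x v)) (λ v → ∸-monoˡ-≤ (δ c v) (m≼y v))
          (λ v → ∸-monoˡ-≤ (δ c v) (m≼z v))
          (λ v → swap (m v ∸ δ c v) (z v ∸ δ c v) {y v ∸ δ c v}
            (sub (δ c v) (z v ∸ δ c v) (x v ∸ δ c v) (d≤m v) (≤-trans (d≤m v) (m≼y v))
              (swap (z v ∸ δ c v) (m v) {x v ∸ δ c v}
                (sub (δ c v) (m v) (y v) (≤-trans (d≤m v) (m≼z v)) (≤-trans (d≤m v) (m≼x v)) (bal v)))))

      shrink : ∀ {c} {k} → m c ≡ 0 → m ≼ k → m ≼ k ⊖ δ c
      shrink {c} m≡0 m≼k v with c ≟ v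
      ... | yes refl = ≤-trans (≤-reflexive m≡0) z≤n
      ... | no _     = m≼k v

      top : ∀ {c} → End c → 0 < z c → ρ⁺ z ≤ suc (ρ (z ⊖ δ c)) → ρ⁺ m ≤ ρ m → Goal
      top {c} end 0<z hz hm with m c in eq
      ... | suc _ = both end (≤-trans (s≤s z≤n) (≤-reflexive (sym eq))) hz
              (≤-trans hm (maxHeight-unit es c (m ⊖ δ c) λ v → m≤n+m∸n (m v) (δ c v)))
      ... | zero with x c in eqx
      ...   | suc _ = ≤-trans (+-mono-≤ hz hm) (≤-trans
                (s≤s (maxHeight-submodular es (shrink {c} eq m≼x) m≼y (shrink {c} eq m≼z)
                  λ v → sub (δ c v) (m v) (y v) (δ≼ c z 0<z v) (δ≼ c x 0<x v) (bal v)))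
                (+-mono-≤ (use {m = x} end 0<x) skip))
        where
        0<x : 0 < x c
        0<x = ≤-trans (s≤s z≤n) (≤-reflexive (sym eqx))
      ...   | zero = ≤-trans (+-mono-≤ hz hm) (≤-trans
                (s≤s (maxHeight-submodular es (shrink {c} eq m≼y) m≼x (shrink {c} eq m≼z)
                  λ v → sub (δ c v) (m v) (x v) (δ≼ c z 0<z v) (δ≼ c y 0<y v)
                    (≤-trans (bal v) (≤-reflexive (+-comm (x v) (y v))))))
                (≤-trans (+-mono-≤ (use {m = y} end 0<y) skip) (≤-reflexive (+-comm (ρ⁺ y) (ρ⁺ x)))))
        where
        0<y : 0 < y c
        0<y = ≤-trans 0<z (≤-trans (m≤m+n (z c) (m c)) (≤-trans (bal c) (≤-reflexive (cong (_+ y c) eqx))))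

      bottom-∞ : ρ⁺ m ≤ ρ m → Goal
      bottom-∞ hm with cases z
      ... | inj₁ hz = ≤-trans (+-mono-≤ hz hm)
              (≤-trans (maxHeight-submodular es m≼x m≼y m≼z bal) (+-mono-≤ skip skip))
      ... | inj₂ (c , end , 0<z , hz) = top end 0<z hz hm

      result : Goal
      result with cases m
      ... | inj₁ hm = bottom-∞ hm
      ... | inj₂ (c , end , 0<m , hm) with ρ m ≤? ρ (m ⊖ δ c)
      ...   | no ≰   = bottom-∞ (≤-trans hm (≰⇒> ≰))
      ...   | yes ≤m = both end 0<m (≤-trans (ρ⁺≤1+ρ z) (s≤s ρz≤)) hm
        where
        ρz≤ : ρ z ≤ ρ (z ⊖ δ c)
        ρz≤ = +-cancelʳ-≤ (ρ (m ⊖ δ c)) (ρ z) (ρ (z ⊖ δ c)) (≤-trans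
          (maxHeight-submodular es
            (λ v → ∸-monoˡ-≤ (δ c v) (m≼z v)) (λ v → m∸n≤m (m v) (δ c v))
            (λ v → ≤-trans (m∸n≤m (m v) (δ c v)) (m≼z v))
            (λ v → swap (m v ∸ δ c v) (z v) {m v} {z v ∸ δ c v}
              (≤-trans (sub (δ c v) (z v) (m v) (δ≼ c m 0<m v) (≤-trans (δ≼ c m 0<m v) (m≼z v)) (≤-reflexive (+-comm (m v) (z v))))
                (≤-reflexive (+-comm (z v ∸ δ c v) (m v))))))
          (+-monoʳ-≤ (ρ (z ⊖ δ c)) ≤m))

    maxHeight-0 : ∀ es {m} → (∀ v → m v ≡ 0) → maxHeight es m ≡ 0
    maxHeight-0 es {m} m≡0 with maxHeight-attained es m
    ... | φ , (_ , φ≤m) , eq = trans eq (height-0 φ λ v → n≤0⇒n≡0 (≤-trans (φ≤m v) (≤-reflexive (m≡0 v))))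
      where
      height-0 : ∀ {q} (φ : Vec (Maybe V) q) → (∀ v → fibre φ v ≡ 0) → height φ ≡ 0
      height-0 []            _ = refl
      height-0 (nothing ∷ φ) h = height-0 φ h
      height-0 (just c ∷ φ)  h with c ≟ c | h c
      ... | yes _  | ()
      ... | no c≢c | _ = contradiction refl c≢c

    maxHeight-mult : ∀ es {n} (f : Fin n → V) X → maxHeight es (mult f X) ≤ ∣ X ∣
    maxHeight-mult es f []            = ≤-reflexive (maxHeight-0 es λ _ → refl)
    maxHeight-mult es f (outside ∷ X) = maxHeight-mult es (f ∘ suc) X
    maxHeight-mult es f (inside ∷ X)  =
      ≤-trans (maxHeight-unit es (f zero) (mult (f ∘ suc) X) ≼) (s≤s (maxHeight-mult es (f ∘ suc) X))
      where
      ≼ : mult f (inside ∷ X) ≼ δ (f zero) ⊕ mult (f ∘ suc) X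
      ≼ v with f zero ≟ v
      ... | yes _ = ≤-refl
      ... | no _  = ≤-refl

    mult-mono : ∀ {n} (f : Fin n → V) {X Y} → X ⊆ Y → mult f X ≼ mult f Y
    mult-mono f {X} {Y} X⊆Y v = p⊆q⇒∣p∣≤∣q∣ λ x∈ →
      let (x∈X , x∈P) = x∈p∩q⁻ X _ x∈ in x∈p∩q⁺ (X⊆Y x∈X , x∈P)

    ∣∪∣+∣∩∣ : ∀ {n} (X Y P : Subset n) →
              ∣ (X ∪ Y) ∩ P ∣ + ∣ (X ∩ Y) ∩ P ∣ ≡ ∣ X ∩ P ∣ + ∣ Y ∩ P ∣
    ∣∪∣+∣∩∣ [] [] [] = refl
    ∣∪∣+∣∩∣ (outside ∷ X) (outside ∷ Y) (_ ∷ P)       = ∣∪∣+∣∩∣ X Y P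
    ∣∪∣+∣∩∣ (inside ∷ X)  (outside ∷ Y) (outside ∷ P) = ∣∪∣+∣∩∣ X Y P
    ∣∪∣+∣∩∣ (inside ∷ X)  (outside ∷ Y) (inside ∷ P)  = cong suc (∣∪∣+∣∩∣ X Y P)
    ∣∪∣+∣∩∣ (outside ∷ X) (inside ∷ Y)  (outside ∷ P) = ∣∪∣+∣∩∣ X Y P
    ∣∪∣+∣∩∣ (outside ∷ X) (inside ∷ Y)  (inside ∷ P)  =
      trans (cong suc (∣∪∣+∣∩∣ X Y P)) (sym (+-suc _ _))
    ∣∪∣+∣∩∣ (inside ∷ X)  (inside ∷ Y)  (outside ∷ P) = ∣∪∣+∣∩∣ X Y P
    ∣∪∣+∣∩∣ (inside ∷ X)  (inside ∷ Y)  (inside ∷ P)  = cong suc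
      (trans (+-suc _ _) (trans (cong suc (∣∪∣+∣∩∣ X Y P)) (sym (+-suc _ _))))

  labelingMatroid : List (V × V) → ∀ {n} → (Fin n → V) → Matroid n
  labelingMatroid es f = record
    { ground          = ⊤
    ; rank            = λ X → maxHeight es (mult f X)
    ; rank-≤-size     = λ {X} _ → maxHeight-mult es f X
    ; rank-mono       = λ X⊆Y _ → maxHeight-mono es (mult-mono f X⊆Y)
    ; rank-submodular = λ {X} {Y} _ _ → maxHeight-submodular es
        (mult-mono f (p∩q⊆p X Y)) (mult-mono f (p∩q⊆q X Y))
        (mult-mono f (⊆-trans (p∩q⊆p X Y) (p⊆p∪q Y)))
        (λ v → ≤-reflexive (∣∪∣+∣∩∣ X Y _))
    }

-- The pairs (v , i) with 1 ≤ i ≤ deg G v, each listed once.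
S : (G : Graph) → List (Vertex G × ℕ)
S G = concatMap (λ v → applyUpTo (λ i → v , suc i) (deg G v)) (allFin (Graph.order G))

-- The element k of the ground set stands for the k-th pair (v , i) in S G.
vertexOf : (G : Graph) → Fin (length (S G)) → Vertex G
vertexOf G k = proj₁ (List.lookup (S G) k)

TM : (G : Graph) → Matroid (length (S G))
TM G = labelingMatroid (Graph.edges G) (vertexOf G)

S[_] : (G : Graph) → Subset (Graph.order G) → Subset (length (S G))
S[ G ] W = Vec.tabulate (λ k → Vec.lookup W (vertexOf G k))

TM[_,_] : (G : Graph) → Subset (Graph.order G) → Matroid (length (S G))
TM[ G , W ] = TM G ∖ S[ G ] W

position : ∀ {p n} → (Fin n → Fin p) → Fin p → Maybe (Fin n)
position v a = Maybe.map proj₁ (dec⇒maybe (any? (λ i → v i ≟ a)))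

renameEdge : ∀ {p n} → (Fin n → Fin p) → Fin p × Fin p → Maybe (Fin n × Fin n)
renameEdge v (a , b) = zip (position v a) (position v b)

-- The subgraph induced on the distinct vertices v 0, …, v (n-1), with v i
-- renamed to i.
induced : (G : Graph) {n : ℕ} → (Fin n → Vertex G) → Graph
induced G {n} v = graph n (mapMaybe (renameEdge v) (Graph.edges G))

-- true directs an edge (a , b) from a to b, false from b to a. The two
-- directions of a loop count as different orientations, but have the same
-- out-degree vector.
Orientation : Graph → Set
Orientation H = Vec Bool (Graph.size H)

orientations : (H : Graph) → List (Orientation H)
orientations H = words (true ∷ false ∷ []) (Graph.size H)

tail : ∀ {A : Set} → A × A → Bool → A
tail (a , b) d = if d then a else b

tails : (H : Graph) → Orientation H → Vec (Vertex H) (Graph.size H)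
tails H = zipWith tail (fromList (Graph.edges H))

outDegrees : (H : Graph) → Orientation H → Vec ℕ (Graph.order H)
outDegrees H O = Vec.tabulate (λ v → count (v ≟_) (tails H O))

-- Each out-degree vector is listed once.
D⁺ : (H : Graph) → List (Vec ℕ (Graph.order H))
D⁺ H = deduplicate (≡-dec ℕ._≟_) (map (outDegrees H) (orientations H))

{-# OPTIONS --safe #-}
module Submission where

-- A basis X of TM(G,W) is an independent set of full rank, i.e. its multiplicities are exactly
-- the fibre sizes of a labeling of all edges that meet V∖W by ends in V∖W. Such a labeling is
-- forced on the edges between W and V∖W, and on G[V∖W] it chooses one end of each edge. The
-- orientation whose tails are the ends not chosen has out-degree deg v − m_X(v) at v ∉ W, so the
-- bases with out-degree vector a are counted by ∏ C(deg v, deg v − a v) = ∏ C(deg v, a v).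

open import Defs
open import Data.Bool using (Bool; true; false; if_then_else_)
open import Data.Fin using (Fin; zero; suc; _≟_)
open import Data.Fin.Properties using (suc-injective; all?; any?)
open import Data.Fin.Subset
  using (Subset; inside; outside; ⊤; ⁅_⁆; _∈_; _∉_; _⊆_; _∩_; _∪_; _─_; ∣_∣) renaming (⊥ to ∅)
open import Data.Fin.Subset.Properties
  using (_∈?_; ∈⊤; ∣⊥∣≡0; ∣⁅x⁆∣≡1; drop-∷-⊆; p⊆p∪q; q⊆p∪q; x∈p∪q⁺; x∈p∪q⁻; x∈p∩q⁺; x∈p∩q⁻; ∣p∩q∣≤∣p∣;
         x∈⁅x⁆; x∈⁅y⁆⇒x≡y; ⊆-refl; ⊆-trans; p⊆q⇒∣p∣≤∣q∣; x∈p∧x∉q⇒x∈p─q)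
open import Data.List
  using (List; []; _∷_; _++_; length; filter; map; tabulate; allFin; concatMap; applyUpTo)
import Data.List as List
open import Data.List.Membership.Propositional using (lose; find) renaming (_∈_ to _∈ₗ_)
open import Data.List.Membership.Propositional.Properties
  using (∈-filter⁺; ∈-allFin; ∈-map⁺; ∈-map⁻; ∈-deduplicate⁺; ∈-deduplicate⁻)
open import Data.List.Properties
  using (map-cong; filter-accept; filter-≐; filter-none; filter-++; length-++; tabulate-cong)
open import Data.List.Relation.Unary.All as All using (All)
open import Data.List.Relation.Unary.All.Properties using (all-filter)
open import Data.List.Relation.Unary.AllPairs using ([]; _∷_)
open import Data.List.Relation.Unary.Any as Any using (Any; here; there)
open import Data.List.Relation.Unary.Unique.DecPropositional.Properties using (deduplicate-!)
open import Data.List.Relation.Unary.Unique.Propositional using (Unique)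
open import Data.Maybe using (Maybe; just; nothing)
open import Data.Nat using (ℕ; zero; suc; _+_; _*_; _∸_; _≤_; _<_; z≤n; s≤s; s≤s⁻¹)
import Data.Nat as ℕ
open import Data.Nat.Combinatorics using (_C_; nCn≡1; nCk≡nC[n∸k]; k>n⇒nCk≡0; nCk+nC[k+1]≡[n+1]C[k+1])
open import Data.Nat.ListAction using (sum; product)
open import Data.Nat.Properties hiding (_≟_; suc-injective)
open import Algebra.Properties.CommutativeMonoid.Sum +-0-commutativeMonoid
  using (sum-cong-≗; ∑-distrib-+; sum-replicate-zero) renaming (sum to ∑)
open import Algebra.Properties.CommutativeSemigroup +-commutativeSemigroup using (x∙yz≈y∙xz)
open import Data.Product using (∃; _×_; _,_; proj₁; proj₂)
open import Data.Sum using (inj₁; inj₂; [_,_]′)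
open import Data.Vec using (Vec; []; _∷_; lookup; here; there)
import Data.Vec as Vec
open import Data.Vec.Properties using ([]=⇒lookup; lookup⇒[]=; lookup∘tabulate; tabulate∘lookup)
import Data.Vec.Properties as Vec
open import Function using (_⇔_; _∘_; id; Injective; Equivalence)
open import Relation.Binary.PropositionalEquality
open import Relation.Nullary using (¬_; yes; no; does; contradiction)
open import Relation.Nullary.Decidable using (_×-dec_; _→-dec_)
open import Relation.Unary using (Decidable; _≐_)
open import Relation.Unary.Properties using (_∪?_)

-- Bases are defined by maximality under inclusion, so their full rank has to be derived from
-- submodularity. Independence gives the exact fibres: the fibres of an optimal labeling are bounded
-- pointwise by the multiplicities of `X`, and their total, the height, equals the size of `X`,
-- which leaves no slack.
--
-- The relation between a basis and an out-degree vector is kept as a sum,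
-- `mult f X (v i) + a i ≡ mult f ⊤ (v i)`. This avoids truncated subtraction, makes `a` a function
-- of `X`, so that the classes of bases are disjoint, and survives the removal of one element of the
-- ground set. The product of binomial coefficients then comes from Pascal's rule, one element at a
-- time; for this induction the degree is replaced by `mult f ⊤`, which makes sense for any map `f`
-- from a finite set to the vertices.

-- Counting list entries that satisfy a decidable predicate

module _ {A : Set} where

  ♯ : {P : A → Set} → Decidable P → List A → ℕ
  ♯ P? xs = length (filter P? xs)

  ♯-cong : {P Q : A → Set} (P? : Decidable P) (Q? : Decidable Q) → P ≐ Q → ∀ xs → ♯ P? xs ≡ ♯ Q? xs
  ♯-cong P? Q? P≐Q xs = cong length (filter-≐ P? Q? P≐Q xs)

  ♯-none : {P : A → Set} (P? : Decidable P) → (∀ x → ¬ P x) → ∀ xs → ♯ P? xs ≡ 0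
  ♯-none P? ¬P xs = cong length (filter-none P? (All.universal ¬P xs))

  ♯-++ : {P : A → Set} (P? : Decidable P) → ∀ xs ys → ♯ P? (xs ++ ys) ≡ ♯ P? xs + ♯ P? ys
  ♯-++ P? xs ys = trans (cong length (filter-++ P? xs ys)) (length-++ (filter P? xs))

  ♯-∪ : {P Q : A → Set} (P? : Decidable P) (Q? : Decidable Q) → (∀ {x} → P x → ¬ Q x) →
        ∀ xs → ♯ (P? ∪? Q?) xs ≡ ♯ P? xs + ♯ Q? xs
  ♯-∪ P? Q? disjoint []       = refl
  ♯-∪ P? Q? disjoint (x ∷ xs) with P? x | Q? x
  ... | yes p | yes q = contradiction q (disjoint p)
  ... | yes _ | no _  = cong suc (♯-∪ P? Q? disjoint xs)
  ... | no _  | yes _ = trans (cong suc (♯-∪ P? Q? disjoint xs)) (sym (+-suc _ _))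
  ... | no _  | no _  = ♯-∪ P? Q? disjoint xs

  -- An entry can satisfy `Q b` for at most one `b`, so over a list without repetition the union is
  -- disjoint. This is what splits the bases by their out-degree vector.
  ♯-Any : {B : Set} {Q : B → A → Set} (Q? : ∀ b → Decidable (Q b)) →
          (∀ {b c x} → Q b x → Q c x → b ≡ c) → ∀ {bs} → Unique bs → ∀ xs →
          ♯ (λ x → Any.any? (λ b → Q? b x) bs) xs ≡ sum (map (λ b → ♯ (Q? b) xs) bs)
  ♯-Any {Q = Q} Q? functional {[]} [] xs = ♯-none (λ x → Any.any? (λ b → Q? b x) []) (λ _ ()) xs
  ♯-Any {Q = Q} Q? functional {b ∷ bs} (b∉bs ∷ unique) xs = begin
    ♯ (λ x → Any.any? (λ c → Q? c x) (b ∷ bs)) xs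
      ≡⟨ ♯-cong _ (Q? b ∪? (λ x → Any.any? (λ c → Q? c x) bs)) (Any.toSum , Any.fromSum) xs ⟩
    ♯ (Q? b ∪? (λ x → Any.any? (λ c → Q? c x) bs)) xs
      ≡⟨ ♯-∪ (Q? b) (λ x → Any.any? (λ c → Q? c x) bs) disjoint xs ⟩
    ♯ (Q? b) xs + ♯ (λ x → Any.any? (λ c → Q? c x) bs) xs
      ≡⟨ cong (♯ (Q? b) xs +_) (♯-Any Q? functional unique xs) ⟩
    ♯ (Q? b) xs + sum (map (λ c → ♯ (Q? c) xs) bs) ∎
    where
    open ≡-Reasoning
    disjoint : ∀ {x} → Q b x → ¬ Any (λ c → Q c x) bs
    disjoint q any = All.lookupWith (λ b≢c qc → b≢c (functional q qc)) b∉bs any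

♯-map : ∀ {A B : Set} {P : B → Set} (P? : Decidable P) (f : A → B) xs → ♯ P? (map f xs) ≡ ♯ (P? ∘ f) xs
♯-map P? f []       = refl
♯-map P? f (x ∷ xs) with does (P? (f x))
... | true  = cong suc (♯-map P? f xs)
... | false = ♯-map P? f xs

♯-subsets-suc : ∀ {n} {P : Subset (suc n) → Set} (P? : Decidable P) →
  ♯ P? (subsets (suc n)) ≡ ♯ (P? ∘ (outside ∷_)) (subsets n) + ♯ (P? ∘ (inside ∷_)) (subsets n)
♯-subsets-suc {n} P? = begin
  ♯ P? (map (outside ∷_) Xs ++ (map (inside ∷_) Xs ++ []))
    ≡⟨ ♯-++ P? (map (outside ∷_) Xs) _ ⟩
  ♯ P? (map (outside ∷_) Xs) + ♯ P? (map (inside ∷_) Xs ++ [])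
    ≡⟨ cong₂ _+_ (♯-map P? (outside ∷_) Xs)
         (trans (♯-++ P? (map (inside ∷_) Xs) []) (trans (+-identityʳ _) (♯-map P? (inside ∷_) Xs))) ⟩
  ♯ (P? ∘ (outside ∷_)) Xs + ♯ (P? ∘ (inside ∷_)) Xs ∎
  where
  open ≡-Reasoning
  Xs = subsets n

-- Bases of a matroid are the independent sets of full rank

p⊆q∧∣q∣≤∣p∣⇒p≡q : ∀ {n} {p q : Subset n} → p ⊆ q → ∣ q ∣ ≤ ∣ p ∣ → p ≡ q
p⊆q∧∣q∣≤∣p∣⇒p≡q {p = []}          {[]}          _   _ = refl
p⊆q∧∣q∣≤∣p∣⇒p≡q {p = outside ∷ _} {outside ∷ _} p⊆q h =
  cong (outside ∷_) (p⊆q∧∣q∣≤∣p∣⇒p≡q (drop-∷-⊆ p⊆q) h)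
p⊆q∧∣q∣≤∣p∣⇒p≡q {p = outside ∷ _} {inside ∷ _}  p⊆q h =
  contradiction (≤-trans h (p⊆q⇒∣p∣≤∣q∣ (drop-∷-⊆ p⊆q))) 1+n≰n
p⊆q∧∣q∣≤∣p∣⇒p≡q {p = inside ∷ _}  {outside ∷ _} p⊆q _ with () ← p⊆q here
p⊆q∧∣q∣≤∣p∣⇒p≡q {p = inside ∷ _}  {inside ∷ _}  p⊆q (s≤s h) =
  cong (inside ∷_) (p⊆q∧∣q∣≤∣p∣⇒p≡q (drop-∷-⊆ p⊆q) h)

∣p∪q∣≤∣p∣+∣q∣ : ∀ {n} (p q : Subset n) → ∣ p ∪ q ∣ ≤ ∣ p ∣ + ∣ q ∣
∣p∪q∣≤∣p∣+∣q∣ []            []            = z≤n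
∣p∪q∣≤∣p∣+∣q∣ (outside ∷ p) (outside ∷ q) = ∣p∪q∣≤∣p∣+∣q∣ p q
∣p∪q∣≤∣p∣+∣q∣ (outside ∷ p) (inside ∷ q)  = ≤-trans (s≤s (∣p∪q∣≤∣p∣+∣q∣ p q)) (≤-reflexive (sym (+-suc _ _)))
∣p∪q∣≤∣p∣+∣q∣ (inside ∷ p)  (outside ∷ q) = s≤s (∣p∪q∣≤∣p∣+∣q∣ p q)
∣p∪q∣≤∣p∣+∣q∣ (inside ∷ p)  (inside ∷ q)  = s≤s (≤-trans (∣p∪q∣≤∣p∣+∣q∣ p q) (+-monoʳ-≤ ∣ p ∣ (n≤1+n ∣ q ∣)))

module _ {n : ℕ} (M : Matroid n) where
  open Matroid M

  private
    ⁅⁆⊆ground : ∀ {x} → x ∈ ground → ⁅ x ⁆ ⊆ ground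
    ⁅⁆⊆ground {x} x∈ y∈ = subst (_∈ ground) (sym (x∈⁅y⁆⇒x≡y x y∈)) x∈

    ∪⊆ : ∀ {X Y Z : Subset n} → X ⊆ Z → Y ⊆ Z → X ∪ Y ⊆ Z
    ∪⊆ {X} {Y} X⊆Z Y⊆Z x∈ = [ X⊆Z , Y⊆Z ]′ (x∈p∪q⁻ X Y x∈)

  module _ {B : Subset n} (basis : IsBasis B) where
    private
      B⊆ground : B ⊆ ground
      B⊆ground = proj₁ (proj₁ basis)

    -- For `x` outside `B`, maximality makes the enlarged set dependent, so its rank is strictly
    -- below its size, which is at most one more than the rank of `B`.
    rank-∪⁅⁆ : ∀ {x} → x ∈ ground → rank (⁅ x ⁆ ∪ B) ≤ rank B
    rank-∪⁅⁆ {x} x∈ with x ∈? B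
    ... | yes x∈B = rank-mono (∪⊆ (λ y∈ → subst (_∈ B) (sym (x∈⁅y⁆⇒x≡y x y∈)) x∈B) ⊆-refl) B⊆ground
    ... | no x∉B  = ≤-trans (s≤s⁻¹ (≤-trans (≤∧≢⇒< (rank-≤-size ⊆ground) dependent) size))
                            (≤-reflexive (sym (proj₂ (proj₁ basis))))
      where
      ⊆ground : ⁅ x ⁆ ∪ B ⊆ ground
      ⊆ground = ∪⊆ (⁅⁆⊆ground x∈) B⊆ground
      size : ∣ ⁅ x ⁆ ∪ B ∣ ≤ suc ∣ B ∣
      size = ≤-trans (∣p∪q∣≤∣p∣+∣q∣ ⁅ x ⁆ B) (≤-reflexive (cong (_+ ∣ B ∣) (∣⁅x⁆∣≡1 x)))
      dependent : rank (⁅ x ⁆ ∪ B) ≢ ∣ ⁅ x ⁆ ∪ B ∣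
      dependent eq = x∉B (subst (x ∈_)
        (proj₂ basis (⁅ x ⁆ ∪ B) ((λ {_} → ⊆ground) , eq) (q⊆p∪q ⁅ x ⁆ B))
        (x∈p∪q⁺ (inj₁ (x∈⁅x⁆ x))))

    -- Built one element at a time, so that submodularity can be applied along the list.
    adjoin : List (Fin n) → Subset n
    adjoin []       = B
    adjoin (x ∷ xs) = ⁅ x ⁆ ∪ adjoin xs

    B⊆adjoin : ∀ xs → B ⊆ adjoin xs
    B⊆adjoin []       = ⊆-refl
    B⊆adjoin (x ∷ xs) = ⊆-trans (B⊆adjoin xs) (q⊆p∪q ⁅ x ⁆ (adjoin xs))

    adjoin⊆ground : ∀ {xs} → All (_∈ ground) xs → adjoin xs ⊆ ground
    adjoin⊆ground All.[]         = B⊆ground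
    adjoin⊆ground (x∈ All.∷ xs∈) = ∪⊆ (⁅⁆⊆ground x∈) (adjoin⊆ground xs∈)

    ∈-adjoin : ∀ {x xs} → x ∈ₗ xs → x ∈ adjoin xs
    ∈-adjoin {x} (here refl) = x∈p∪q⁺ (inj₁ (x∈⁅x⁆ x))
    ∈-adjoin     (there x∈)  = x∈p∪q⁺ (inj₂ (∈-adjoin x∈))

    -- No single element raises the rank of B; by submodularity neither do several.
    rank-adjoin : ∀ {xs} → All (_∈ ground) xs → rank (adjoin xs) ≤ rank B
    rank-adjoin All.[]                  = ≤-refl
    rank-adjoin {x ∷ xs} (x∈ All.∷ xs∈) = +-cancelʳ-≤ (rank B) _ _ (begin
      rank (⁅ x ⁆ ∪ Y) + rank B
        ≤⟨ +-mono-≤ (rank-mono x∪Y⊆ union⊆ground) (rank-mono B⊆∩ inter⊆ground) ⟩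
      rank ((⁅ x ⁆ ∪ B) ∪ Y) + rank ((⁅ x ⁆ ∪ B) ∩ Y)
        ≤⟨ rank-submodular x∪B⊆ground Y⊆ground ⟩
      rank (⁅ x ⁆ ∪ B) + rank Y
        ≤⟨ +-mono-≤ (rank-∪⁅⁆ x∈) (rank-adjoin xs∈) ⟩
      rank B + rank B ∎)
      where
      open ≤-Reasoning
      Y = adjoin xs
      Y⊆ground : Y ⊆ ground
      Y⊆ground = adjoin⊆ground xs∈
      x∪B⊆ground : ⁅ x ⁆ ∪ B ⊆ ground
      x∪B⊆ground = ∪⊆ (⁅⁆⊆ground x∈) B⊆ground
      union⊆ground : (⁅ x ⁆ ∪ B) ∪ Y ⊆ ground
      union⊆ground = ∪⊆ x∪B⊆ground Y⊆ground
      inter⊆ground : (⁅ x ⁆ ∪ B) ∩ Y ⊆ ground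
      inter⊆ground = Y⊆ground ∘ proj₂ ∘ x∈p∩q⁻ (⁅ x ⁆ ∪ B) Y
      x∪Y⊆ : ⁅ x ⁆ ∪ Y ⊆ (⁅ x ⁆ ∪ B) ∪ Y
      x∪Y⊆ = ∪⊆ (⊆-trans (p⊆p∪q B) (p⊆p∪q Y)) (q⊆p∪q (⁅ x ⁆ ∪ B) Y)
      B⊆∩ : B ⊆ (⁅ x ⁆ ∪ B) ∩ Y
      B⊆∩ y∈ = x∈p∩q⁺ (q⊆p∪q ⁅ x ⁆ B y∈ , B⊆adjoin xs y∈)

    -- Adjoining every element of the ground set to `B` covers the ground set without raising the
    -- rank.
    basis-rank : rank B ≡ rank ground
    basis-rank = ≤-antisym (rank-mono B⊆ground ⊆-refl)
      (≤-trans (rank-mono ground⊆ (adjoin⊆ground all∈)) (rank-adjoin all∈))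
      where
      elements : List (Fin n)
      elements = filter (_∈? ground) (allFin n)
      all∈ : All (_∈ ground) elements
      all∈ = all-filter (_∈? ground) (allFin n)
      ground⊆ : ground ⊆ adjoin elements
      ground⊆ {x} x∈ = ∈-adjoin (∈-filter⁺ (_∈? ground) (∈-allFin x) x∈)

  -- The size of an independent superset is its rank, hence at most the rank of the ground set,
  -- which is the size of `B`.
  independent⇒basis : ∀ {B} → Independent B → rank B ≡ rank ground → IsBasis B
  independent⇒basis {B} ind full = ind , λ X (X⊆ , r≡) B⊆X → sym (p⊆q∧∣q∣≤∣p∣⇒p≡q B⊆X (begin
    ∣ X ∣       ≡⟨ r≡ ⟨
    rank X      ≤⟨ rank-mono X⊆ ⊆-refl ⟩
    rank ground ≡⟨ full ⟨
    rank B      ≡⟨ proj₂ ind ⟩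
    ∣ B ∣       ∎))
    where open ≤-Reasoning

-- Kronecker deltas, finite sums and products, binomial coefficients

bit : Bool → ℕ
bit b = if b then 1 else 0

♯-∷ : ∀ {A : Set} {P : A → Set} (P? : Decidable P) x xs → ♯ P? (x ∷ xs) ≡ bit (does (P? x)) + ♯ P? xs
♯-∷ P? x xs with does (P? x)
... | true  = refl
... | false = refl

δ : ∀ {n} → Fin n → Fin n → ℕ
δ i j = bit (does (i ≟ j))

δ-refl : ∀ {n} (i : Fin n) → δ i i ≡ 1
δ-refl i with i ≟ i
... | yes _  = refl
... | no i≢i = contradiction refl i≢i

δ-≢ : ∀ {n} {i j : Fin n} → i ≢ j → δ i j ≡ 0
δ-≢ {i = i} {j} i≢j with i ≟ j
... | yes i≡j = contradiction i≡j i≢j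
... | no _    = refl

δ-sym : ∀ {n} (i j : Fin n) → δ i j ≡ δ j i
δ-sym i j with i ≟ j
... | yes refl = sym (δ-refl i)
... | no i≢j   = sym (δ-≢ (i≢j ∘ sym))

δ-injective : ∀ {m n} {f : Fin m → Fin n} → Injective _≡_ _≡_ f → ∀ i j → δ (f i) (f j) ≡ δ i j
δ-injective {f = f} injective i j with i ≟ j
... | yes refl = δ-refl (f i)
... | no i≢j   = δ-≢ (i≢j ∘ injective)

∑-δ : ∀ {n} (i : Fin n) → ∑ (δ i) ≡ 1
∑-δ {suc n} zero    = cong suc (sum-replicate-zero n)
∑-δ {suc n} (suc i) = ∑-δ i

∑-mono : ∀ {n} {f g : Fin n → ℕ} → (∀ i → f i ≤ g i) → ∑ f ≤ ∑ g
∑-mono {zero}  h = z≤n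
∑-mono {suc n} h = +-mono-≤ (h zero) (∑-mono (h ∘ suc))

-- Slack at one index would have to be made up at another, where the pointwise bound forbids it.
∑-tight : ∀ {n} {f g : Fin n → ℕ} → (∀ i → f i ≤ g i) → ∑ g ≤ ∑ f → ∀ i → f i ≡ g i
∑-tight {suc n} {f} {g} h ∑g≤∑f zero = ≤-antisym (h zero)
  (+-cancelʳ-≤ (∑ (g ∘ suc)) (g zero) (f zero) (≤-trans ∑g≤∑f (+-monoʳ-≤ (f zero) (∑-mono (h ∘ suc)))))
∑-tight {suc n} {f} {g} h ∑g≤∑f (suc i) = ∑-tight (h ∘ suc)
  (+-cancelˡ-≤ (g zero) (∑ (g ∘ suc)) (∑ (f ∘ suc))
    (≤-trans ∑g≤∑f (+-monoˡ-≤ (∑ (f ∘ suc)) (h zero)))) i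

∏ : ∀ {n} → (Fin n → ℕ) → ℕ
∏ f = product (tabulate f)

∏-cong : ∀ {n} {f g : Fin n → ℕ} → (∀ i → f i ≡ g i) → ∏ f ≡ ∏ g
∏-cong f≗g = cong product (tabulate-cong f≗g)

∏-0 : ∀ {n} (f : Fin n → ℕ) i → f i ≡ 0 → ∏ f ≡ 0
∏-0 f zero    fi≡0 = cong (_* ∏ (f ∘ suc)) fi≡0
∏-0 f (suc i) fi≡0 = trans (cong (f zero *_) (∏-0 (f ∘ suc) i fi≡0)) (*-zeroʳ (f zero))

∏-1 : ∀ n → ∏ {n} (λ _ → 1) ≡ 1
∏-1 zero    = refl
∏-1 (suc n) = trans (+-identityʳ _) (∏-1 n)

-- A product is additive in its factor at `j` when the other factors are fixed. This carries
-- Pascal's rule for one binomial coefficient over to the whole product.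
∏-additive : ∀ {n} (f g h : Fin n → ℕ) j → f j ≡ g j + h j →
             (∀ i → j ≢ i → f i ≡ g i × f i ≡ h i) → ∏ f ≡ ∏ g + ∏ h
∏-additive f g h zero fj rest = begin
  f zero * ∏ (f ∘ suc)                                ≡⟨ cong (_* ∏ (f ∘ suc)) fj ⟩
  (g zero + h zero) * ∏ (f ∘ suc)                     ≡⟨ *-distribʳ-+ (∏ (f ∘ suc)) (g zero) (h zero) ⟩
  g zero * ∏ (f ∘ suc) + h zero * ∏ (f ∘ suc)
    ≡⟨ cong₂ _+_ (cong (g zero *_) (∏-cong λ i → proj₁ (rest (suc i) λ ())))
                 (cong (h zero *_) (∏-cong λ i → proj₂ (rest (suc i) λ ()))) ⟩
  g zero * ∏ (g ∘ suc) + h zero * ∏ (h ∘ suc)         ∎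
  where open ≡-Reasoning
∏-additive f g h (suc j) fj rest = begin
  f zero * ∏ (f ∘ suc)
    ≡⟨ cong (f zero *_) (∏-additive (f ∘ suc) (g ∘ suc) (h ∘ suc) j fj
         λ i j≢i → rest (suc i) (j≢i ∘ suc-injective)) ⟩
  f zero * (∏ (g ∘ suc) + ∏ (h ∘ suc))                ≡⟨ *-distribˡ-+ (f zero) (∏ (g ∘ suc)) (∏ (h ∘ suc)) ⟩
  f zero * ∏ (g ∘ suc) + f zero * ∏ (h ∘ suc)
    ≡⟨ cong₂ (λ x y → x * ∏ (g ∘ suc) + y * ∏ (h ∘ suc))
         (proj₁ (rest zero λ ())) (proj₂ (rest zero λ ())) ⟩
  g zero * ∏ (g ∘ suc) + h zero * ∏ (h ∘ suc)         ∎
  where open ≡-Reasoning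

nC0≡1 : ∀ n → n C 0 ≡ 1
nC0≡1 n = trans (nCk≡nC[n∸k] {0} {n} z≤n) (nCn≡1 n)

∏-C-absorb : ∀ {n} (c a : Fin n → ℕ) j → a j ≡ 0 → ∏ (λ i → (δ j i + c i) C a i) ≡ ∏ (λ i → c i C a i)
∏-C-absorb c a j aj≡0 = ∏-cong pointwise
  where
  pointwise : ∀ i → (δ j i + c i) C a i ≡ c i C a i
  pointwise i with j ≟ i
  ... | yes refl rewrite aj≡0 = trans (nC0≡1 (suc (c j))) (sym (nC0≡1 (c j)))
  ... | no _ = refl

∏-C-Pascal : ∀ {n} (c a : Fin n → ℕ) j → 0 < a j →
  ∏ (λ i → (δ j i + c i) C a i) ≡ ∏ (λ i → c i C (a i ∸ δ j i)) + ∏ (λ i → c i C a i)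
∏-C-Pascal c a j 0<aj = ∏-additive _ _ _ j at-j off-j
  where
  at-j : (δ j j + c j) C a j ≡ c j C (a j ∸ δ j j) + c j C a j
  at-j rewrite δ-refl j = Pascal (a j) 0<aj
    where
    Pascal : ∀ k → 0 < k → suc (c j) C k ≡ c j C (k ∸ 1) + c j C k
    Pascal (suc k) _ = sym (nCk+nC[k+1]≡[n+1]C[k+1] (c j) k)
  off-j : ∀ i → j ≢ i → (δ j i + c i) C a i ≡ c i C (a i ∸ δ j i) × (δ j i + c i) C a i ≡ c i C a i
  off-j i j≢i rewrite δ-≢ j≢i = refl , refl

-- Multiplicities, and the number of subsets with prescribed multiplicities

module _ {p : ℕ} where

  mult-inside : ∀ {n} (f : Fin (suc n) → Fin p) X u →
                mult f (inside ∷ X) u ≡ δ (f zero) u + mult (f ∘ suc) X u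
  mult-inside f X u with f zero ≟ u
  ... | yes _ = refl
  ... | no _  = refl

  -- Inclusion is asked for only over `u`: the whole ground set will be compared with what deletion
  -- leaves, and these agree over vertices outside `W` only.
  mult-mono : ∀ {n} (f : Fin n → Fin p) {X Y} u → (∀ {k} → f k ≡ u → k ∈ X → k ∈ Y) →
              mult f X u ≤ mult f Y u
  mult-mono f {X} u X⊆Y = p⊆q⇒∣p∣≤∣q∣ λ {k} k∈ →
    let (k∈X , k∈P) = x∈p∩q⁻ X _ k∈
        fk≡u        = f≡u k (trans (sym (lookup∘tabulate _ k)) ([]=⇒lookup k∈P))
    in x∈p∩q⁺ (X⊆Y fk≡u k∈X , k∈P)
    where
    f≡u : ∀ k → does (f k ≟ u) ≡ true → f k ≡ u
    f≡u k eq with f k ≟ u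
    ... | yes fk≡u = fk≡u

  mult-positive : ∀ {n} (f : Fin n → Fin p) {X k} → k ∈ X → 0 < mult f X (f k)
  mult-positive f {inside ∷ X} here = ≤-trans
    (≤-reflexive (sym (δ-refl (f zero))))
    (≤-trans (m≤m+n _ (mult (f ∘ suc) X (f zero))) (≤-reflexive (sym (mult-inside f X (f zero)))))
  mult-positive f {outside ∷ X} (there k∈) = mult-positive (f ∘ suc) k∈
  mult-positive f {inside ∷ X} {suc k} (there k∈) = ≤-trans (mult-positive (f ∘ suc) k∈)
    (≤-trans (m≤n+m _ (δ (f zero) (f (suc k)))) (≤-reflexive (sym (mult-inside f X (f (suc k))))))

  ∑-mult : ∀ {n} (f : Fin n → Fin p) X → ∑ (mult f X) ≡ ∣ X ∣
  ∑-mult f []            = sum-replicate-zero p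
  ∑-mult f (outside ∷ X) = ∑-mult (f ∘ suc) X
  ∑-mult f (inside ∷ X)  = begin
    ∑ (mult f (inside ∷ X))                           ≡⟨ sum-cong-≗ (mult-inside f X) ⟩
    ∑ (λ u → δ (f zero) u + mult (f ∘ suc) X u)       ≡⟨ ∑-distrib-+ (δ (f zero)) _ ⟩
    ∑ (δ (f zero)) + ∑ (mult (f ∘ suc) X)             ≡⟨ cong₂ _+_ (∑-δ (f zero)) (∑-mult (f ∘ suc) X) ⟩
    suc ∣ X ∣                                         ∎
    where open ≡-Reasoning

  module _ (W : Subset p) {n : ℕ} (v : Fin n → Fin p)
           (injective : Injective _≡_ _≡_ v) (W-complement : ∀ u → u ∉ W ⇔ (∃ λ i → v i ≡ u)) where

    v∉W : ∀ i → v i ∉ W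
    v∉W i = Equivalence.from (W-complement (v i)) (i , refl)

    -- a counts the elements over v i missing from X: for a basis X this is an out-degree vector.
    Fits : ∀ {N} → (Fin N → Fin p) → (Fin n → ℕ) → Subset N → Set
    Fits f a X = (∀ u → u ∈ W → mult f X u ≡ 0) × (∀ i → mult f X (v i) + a i ≡ mult f ⊤ (v i))

    fits? : ∀ {N} f a → Decidable (Fits {N} f a)
    fits? f a X = all? (λ u → (u ∈? W) →-dec (mult f X u ℕ.≟ 0))
                  ×-dec all? (λ i → mult f X (v i) + a i ℕ.≟ mult f ⊤ (v i))

    module Step {N} (f : Fin (suc N) → Fin p) (a : Fin n → ℕ) where

      ∈W-inside : f zero ∈ W → ∀ X → ¬ Fits f a (inside ∷ X)
      ∈W-inside w∈W X (0-on-W , _) = contradiction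
        (trans (sym (δ-refl (f zero))) (m+n≡0⇒m≡0 (δ (f zero) (f zero))
          (trans (sym (mult-inside f X (f zero))) (0-on-W (f zero) w∈W)))) λ ()

      ∈W-mult⊤ : f zero ∈ W → ∀ i → mult f ⊤ (v i) ≡ mult (f ∘ suc) ⊤ (v i)
      ∈W-mult⊤ w∈W i = trans (mult-inside f ⊤ (v i)) (cong (_+ mult (f ∘ suc) ⊤ (v i))
        (δ-≢ {i = f zero} {v i} λ eq → v∉W i (subst (_∈ W) eq w∈W)))

      ∈W-outside : f zero ∈ W → (Fits f a ∘ (outside ∷_)) ≐ Fits (f ∘ suc) a
      ∈W-outside w∈W = (λ (z , h) → z , λ i → trans (h i) (∈W-mult⊤ w∈W i))
                     , (λ (z , h) → z , λ i → trans (h i) (sym (∈W-mult⊤ w∈W i)))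

      module _ (j : Fin n) (vj≡ : v j ≡ f zero) where

        mult-inside-v : ∀ X i → mult f (inside ∷ X) (v i) ≡ δ j i + mult (f ∘ suc) X (v i)
        mult-inside-v X i = trans (mult-inside f X (v i)) (cong (_+ mult (f ∘ suc) X (v i))
          (trans (cong (λ w → δ w (v i)) (sym vj≡)) (δ-injective injective j i)))

        mult⊤-v : ∀ i → mult f ⊤ (v i) ≡ δ j i + mult (f ∘ suc) ⊤ (v i)
        mult⊤-v = mult-inside-v ⊤

        mult-inside-W : ∀ X u → u ∈ W → mult f (inside ∷ X) u ≡ mult (f ∘ suc) X u
        mult-inside-W X u u∈W = trans (mult-inside f X u) (cong (_+ mult (f ∘ suc) X u)
          (δ-≢ λ eq → v∉W j (subst (_∈ W) (sym (trans vj≡ eq)) u∈W)))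

        v-inside : (Fits f a ∘ (inside ∷_)) ≐ Fits (f ∘ suc) a
        v-inside =
          (λ {X} (z , h) → (λ u u∈ → trans (sym (mult-inside-W X u u∈)) (z u u∈)) ,
            λ i → +-cancelˡ-≡ (δ j i) _ _ (trans (sym (+-assoc (δ j i) _ _))
              (trans (cong (_+ a i) (sym (mult-inside-v X i))) (trans (h i) (mult⊤-v i)))))
          ,
          (λ {X} (z , h) → (λ u u∈ → trans (mult-inside-W X u u∈) (z u u∈)) ,
            λ i → trans (cong (_+ a i) (mult-inside-v X i)) (trans (+-assoc (δ j i) _ _)
              (trans (cong (δ j i +_) (h i)) (sym (mult⊤-v i)))))

        -- With no element over `v j` allowed to be missing, the tail of `X` would need one more
        -- element over `v j` than there are.
        v-outside-0 : a j ≡ 0 → ∀ X → ¬ Fits f a (outside ∷ X)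
        v-outside-0 aj≡0 X (_ , h) = 1+n≰n (begin
          suc (mult (f ∘ suc) ⊤ (v j))       ≡⟨ cong (_+ mult (f ∘ suc) ⊤ (v j)) (δ-refl j) ⟨
          δ j j + mult (f ∘ suc) ⊤ (v j)     ≡⟨ mult⊤-v j ⟨
          mult f ⊤ (v j)                     ≡⟨ h j ⟨
          mult (f ∘ suc) X (v j) + a j       ≡⟨ cong (mult (f ∘ suc) X (v j) +_) aj≡0 ⟩
          mult (f ∘ suc) X (v j) + 0         ≡⟨ +-identityʳ _ ⟩
          mult (f ∘ suc) X (v j)             ≤⟨ mult-mono (f ∘ suc) {X} (v j) (λ _ _ → ∈⊤) ⟩
          mult (f ∘ suc) ⊤ (v j)             ∎)
          where open ≤-Reasoning

        δ≤a : 0 < a j → ∀ i → δ j i ≤ a i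
        δ≤a 0<aj i with j ≟ i
        ... | yes refl = 0<aj
        ... | no _     = z≤n

        v-outside-suc : 0 < a j → (Fits f a ∘ (outside ∷_)) ≐ Fits (f ∘ suc) (λ i → a i ∸ δ j i)
        v-outside-suc 0<aj =
          (λ {X} (z , h) → z , λ i → +-cancelˡ-≡ (δ j i) _ _
            (trans (move X i) (trans (h i) (mult⊤-v i))))
          ,
          (λ {X} (z , h) → z , λ i → trans (sym (move X i))
            (trans (cong (δ j i +_) (h i)) (sym (mult⊤-v i))))
          where
          open ≡-Reasoning
          move : ∀ X i → δ j i + (mult (f ∘ suc) X (v i) + (a i ∸ δ j i)) ≡ mult (f ∘ suc) X (v i) + a i
          move X i = begin
            δ j i + (mult (f ∘ suc) X (v i) + (a i ∸ δ j i)) ≡⟨ +-comm (δ j i) _ ⟩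
            mult (f ∘ suc) X (v i) + (a i ∸ δ j i) + δ j i   ≡⟨ +-assoc (mult (f ∘ suc) X (v i)) _ _ ⟩
            mult (f ∘ suc) X (v i) + (a i ∸ δ j i + δ j i)
              ≡⟨ cong (mult (f ∘ suc) X (v i) +_) (m∸n+n≡m (δ≤a 0<aj i)) ⟩
            mult (f ∘ suc) X (v i) + a i                     ∎

    -- Induction on the ground set. An element over `W` must be left out, and it does not affect
    -- `mult f ⊤ (v i)`. An element over `v j` that is taken counts on both sides of the equation
    -- and leaves `a` unchanged; one that is left out uses up a unit of `a j`. The counts therefore
    -- obey Pascal's rule in the factor at `j`.
    ♯-fits : ∀ {N} (f : Fin N → Fin p) (a : Fin n → ℕ) →
             ♯ (fits? f a) (subsets N) ≡ ∏ (λ i → mult f ⊤ (v i) C a i)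
    -- All multiplicities are 0 here: the empty subset fits exactly when `a` vanishes, and `0 C a i`
    -- is 1 or 0 accordingly.
    ♯-fits {zero} f a with any? (λ i → 0 ℕ.<? a i)
    ... | yes (i , 0<ai) = trans
      (♯-none (fits? f a) (λ { [] (_ , h) → <⇒≢ 0<ai (sym (h i)) }) (subsets 0))
      (sym (∏-0 _ i (k>n⇒nCk≡0 0<ai)))
    ... | no none = trans
      (cong length (filter-accept (fits? f a) {x = []} {xs = []} ((λ _ _ → refl) , a≡0)))
      (sym (trans (∏-cong λ i → cong (0 C_) (a≡0 i)) (∏-1 n)))
      where
      a≡0 : ∀ i → a i ≡ 0
      a≡0 i = n≤0⇒n≡0 (≮⇒≥ λ 0<ai → none (i , 0<ai))
    ♯-fits {suc N} f a with f zero ∈? W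
    ... | yes w∈W = begin
      ♯ (fits? f a) (subsets (suc N))
        ≡⟨ ♯-subsets-suc (fits? f a) ⟩
      ♯ (fits? f a ∘ (outside ∷_)) (subsets N) + ♯ (fits? f a ∘ (inside ∷_)) (subsets N)
        ≡⟨ cong₂ _+_ (♯-cong _ (fits? (f ∘ suc) a) (∈W-outside w∈W) (subsets N))
                     (♯-none (fits? f a ∘ (inside ∷_)) (∈W-inside w∈W) (subsets N)) ⟩
      ♯ (fits? (f ∘ suc) a) (subsets N) + 0
        ≡⟨ +-identityʳ _ ⟩
      ♯ (fits? (f ∘ suc) a) (subsets N)
        ≡⟨ ♯-fits (f ∘ suc) a ⟩
      ∏ (λ i → mult (f ∘ suc) ⊤ (v i) C a i)
        ≡⟨ ∏-cong (λ i → cong (_C a i) (∈W-mult⊤ w∈W i)) ⟨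
      ∏ (λ i → mult f ⊤ (v i) C a i) ∎
      where
      open ≡-Reasoning
      open Step f a
    ... | no w∉W with Equivalence.to (W-complement (f zero)) w∉W
    ...   | j , vj≡ = begin
      ♯ (fits? f a) (subsets (suc N))
        ≡⟨ ♯-subsets-suc (fits? f a) ⟩
      ♯ (fits? f a ∘ (outside ∷_)) (subsets N) + ♯ (fits? f a ∘ (inside ∷_)) (subsets N)
        ≡⟨ cong (♯ (fits? f a ∘ (outside ∷_)) (subsets N) +_)
             (trans (♯-cong _ (fits? (f ∘ suc) a) (v-inside j vj≡) (subsets N)) (♯-fits (f ∘ suc) a)) ⟩
      ♯ (fits? f a ∘ (outside ∷_)) (subsets N) + ∏ (λ i → mult (f ∘ suc) ⊤ (v i) C a i)
        ≡⟨ Pascal (a j) refl ⟩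
      ∏ (λ i → (δ j i + mult (f ∘ suc) ⊤ (v i)) C a i)
        ≡⟨ ∏-cong (λ i → cong (_C a i) (mult⊤-v j vj≡ i)) ⟨
      ∏ (λ i → mult f ⊤ (v i) C a i) ∎
      where
      open ≡-Reasoning
      open Step f a
      c : Fin n → ℕ
      c i = mult (f ∘ suc) ⊤ (v i)
      -- The case `a j ≡ 0` is separate because the truncated `a j ∸ 1` would then be 0 again,
      -- counting subsets although none may leave the element out.
      Pascal : ∀ k → a j ≡ k → ♯ (fits? f a ∘ (outside ∷_)) (subsets N) + ∏ (λ i → c i C a i)
                               ≡ ∏ (λ i → (δ j i + c i) C a i)
      Pascal zero    aj≡0 = trans
        (cong (_+ ∏ (λ i → c i C a i))
          (♯-none (fits? f a ∘ (outside ∷_)) (v-outside-0 j vj≡ aj≡0) (subsets N)))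
        (sym (∏-C-absorb c a j aj≡0))
      Pascal (suc k) aj≡ = trans
        (cong (_+ ∏ (λ i → c i C a i)) (trans
          (♯-cong _ (fits? (f ∘ suc) (λ i → a i ∸ δ j i)) (v-outside-suc j vj≡ 0<aj) (subsets N))
          (♯-fits (f ∘ suc) (λ i → a i ∸ δ j i))))
        (sym (∏-C-Pascal c a j 0<aj))
        where
        0<aj : 0 < a j
        0<aj = subst (0 <_) (sym aj≡) (s≤s z≤n)

-- Labelings and orientations, edge by edge

outDegree : (H : Graph) → Orientation H → Vertex H → ℕ
outDegree H O i = Vec.count (i ≟_) (tails H O)

module _ {p : ℕ} where

  count-∷ : ∀ {n m} (u : Fin n) x (xs : Vec (Fin n) m) →
            Vec.count (u ≟_) (x ∷ xs) ≡ δ x u + Vec.count (u ≟_) xs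
  count-∷ u x xs rewrite δ-sym x u with does (u ≟ x)
  ... | true  = refl
  ... | false = refl

  deg-∷ : ∀ a b es u → deg (graph p ((a , b) ∷ es)) u ≡ δ a u + (δ b u + deg (graph p es) u)
  deg-∷ a b es u rewrite δ-sym a u | δ-sym b u = trans
    (♯-∷ (u ≟_) a _) (cong (δ u a +_) (♯-∷ (u ≟_) b _))

  fibre-just : ∀ {q} c (φ : Vec (Maybe (Fin p)) q) u → fibre (just c ∷ φ) u ≡ δ c u + fibre φ u
  fibre-just c φ u with c ≟ u
  ... | yes _ = refl
  ... | no _  = refl

  ∑-fibre : ∀ {q} (φ : Vec (Maybe (Fin p)) q) → ∑ (fibre φ) ≡ height φ
  ∑-fibre []            = sum-replicate-zero p
  ∑-fibre (nothing ∷ φ) = ∑-fibre φ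
  ∑-fibre (just c ∷ φ)  = begin
    ∑ (fibre (just c ∷ φ))         ≡⟨ sum-cong-≗ (fibre-just c φ) ⟩
    ∑ (λ u → δ c u + fibre φ u)    ≡⟨ ∑-distrib-+ (δ c) (fibre φ) ⟩
    ∑ (δ c) + ∑ (fibre φ)          ≡⟨ cong₂ _+_ (∑-δ c) (∑-fibre φ) ⟩
    suc (height φ)                 ∎
    where open ≡-Reasoning

  module Orienting {n : ℕ} (v : Fin n → Fin p) (injective : Injective _≡_ _≡_ v) where

    -- A view of `position`. Matching on it along with `position v u` lets `live` and the `mapMaybe`
    -- inside `induced` compute, and in the case `hit` puts `v i` in place of `u`.
    data Position : Fin p → Maybe (Fin n) → Set where
      hit  : ∀ i → Position (v i) (just i)
      miss : ∀ {u} → (∀ i → v i ≢ u) → Position u nothing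

    position-view : ∀ u → Position u (position v u)
    position-view u with any? (λ i → v i ≟ u)
    ... | yes (i , refl) = hit i
    ... | no none        = miss λ i vi≡u → none (i , vi≡u)

    live : Maybe (Fin n) → Maybe (Fin n) → ℕ
    live nothing  nothing  = 0
    live nothing  (just _) = 1
    live (just _) _        = 1

    -- The number of edges with an end in the range of `v`, which turns out to be the rank after
    -- deletion.
    liveEdges : List (Fin p × Fin p) → ℕ
    liveEdges []             = 0
    liveEdges ((a , b) ∷ es) = live (position v a) (position v b) + liveEdges es

    H : List (Fin p × Fin p) → Graph
    H es = induced (graph p es) v

    AllAllowed : (es : List (Fin p × Fin p)) → Labels es → Set
    AllAllowed es φ = ∀ e → Allowed (List.lookup es e) (lookup φ e)

    -- The effect on a labeling of deleting the elements over `W`, whose vertices are those missed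
    -- by `v`.
    Avoids : ∀ {q} → Vec (Maybe (Fin p)) q → Set
    Avoids φ = ∀ u → (∀ i → v i ≢ u) → fibre φ u ≡ 0

    avoids-tail : ∀ {q} c (φ : Vec (Maybe (Fin p)) q) → Avoids (just c ∷ φ) → Avoids φ
    avoids-tail c φ off u missed = m+n≡0⇒n≡0 (δ c u) (trans (sym (fibre-just c φ u)) (off u missed))

    avoids-head : ∀ {q} {c} (φ : Vec (Maybe (Fin p)) q) → Avoids (just c ∷ φ) → ¬ (∀ i → v i ≢ c)
    avoids-head {c = c} φ off missed = contradiction
      (trans (sym (δ-refl c)) (m+n≡0⇒m≡0 (δ c c) (trans (sym (fibre-just c φ c)) (off c missed)))) λ ()

    avoids-∷ : ∀ {q} i (φ : Vec (Maybe (Fin p)) q) → Avoids φ → Avoids (just (v i) ∷ φ)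
    avoids-∷ i φ off u missed = trans (fibre-just (v i) φ u) (cong₂ _+_ (δ-≢ (missed i)) (off u missed))

    -- A label other than ∞ is an end of its edge, and `Avoids` puts that end in the range of `v`.
    height≤liveEdges : ∀ es φ → AllAllowed es φ → Avoids φ → height φ ≤ liveEdges es
    height≤liveEdges [] [] _ _ = z≤n
    height≤liveEdges ((a , b) ∷ es) (nothing ∷ φ) ok off =
      ≤-trans (height≤liveEdges es φ (ok ∘ suc) off) (m≤n+m _ (live (position v a) (position v b)))
    height≤liveEdges ((a , b) ∷ es) (just c ∷ φ) ok off
      with position v a | position-view a | position v b | position-view b | ok zero
    ... | just _  | _      | _       | _      | _ =
      s≤s (height≤liveEdges es φ (ok ∘ suc) (avoids-tail c φ off))
    ... | nothing | _      | just _  | _      | _ =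
      s≤s (height≤liveEdges es φ (ok ∘ suc) (avoids-tail c φ off))
    ... | nothing | miss m | nothing | miss _ | inj₁ refl        = contradiction m (avoids-head φ off)
    ... | nothing | miss _ | nothing | miss m | inj₂ (inj₁ refl) = contradiction m (avoids-head φ off)

    -- Each edge is balanced by itself. An edge inside the range of `v` gives one end to the label
    -- and the other to the tail, so a loop counts twice as in the degree; an edge with a single end
    -- in the range gives that end to the label and has no arc in `H es`. As a sum, the equation
    -- also bounds the fibres by the degrees.
    Complementary : ∀ es → Labels es → Orientation (H es) → Set
    Complementary es φ O = ∀ k → fibre φ (v k) + outDegree (H es) O k ≡ deg (graph p es) (v k)

    dead-edge : ∀ {a b} es {f o : Fin n → ℕ} → (∀ i → v i ≢ a) → (∀ i → v i ≢ b) →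
      (∀ k → f k + o k ≡ deg (graph p es) (v k)) →
      ∀ k → f k + o k ≡ deg (graph p ((a , b) ∷ es)) (v k)
    dead-edge {a} {b} es {f} {o} ma mb h k = begin
      f k + o k                                              ≡⟨ h k ⟩
      deg (graph p es) (v k)
        ≡⟨ cong₂ (λ x y → x + (y + deg (graph p es) (v k))) (δ-≢ (ma k ∘ sym)) (δ-≢ (mb k ∘ sym)) ⟨
      δ a (v k) + (δ b (v k) + deg (graph p es) (v k))       ≡⟨ deg-∷ a b es (v k) ⟨
      deg (graph p ((a , b) ∷ es)) (v k)                     ∎
      where open ≡-Reasoning

    boundary-edge : ∀ {b} i es (φ : Labels es) {o : Fin n → ℕ} → (∀ i → v i ≢ b) →
      (∀ k → fibre φ (v k) + o k ≡ deg (graph p es) (v k)) →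
      ∀ k → fibre (just (v i) ∷ φ) (v k) + o k ≡ deg (graph p ((v i , b) ∷ es)) (v k)
    boundary-edge {b} i es φ {o} mb h k = begin
      fibre (just (v i) ∷ φ) (v k) + o k                     ≡⟨ cong (_+ o k) (fibre-just (v i) φ (v k)) ⟩
      δ (v i) (v k) + fibre φ (v k) + o k                    ≡⟨ +-assoc (δ (v i) (v k)) _ _ ⟩
      δ (v i) (v k) + (fibre φ (v k) + o k)                  ≡⟨ cong (δ (v i) (v k) +_) (h k) ⟩
      δ (v i) (v k) + deg (graph p es) (v k)
        ≡⟨ cong (λ y → δ (v i) (v k) + (y + deg (graph p es) (v k))) (δ-≢ (mb k ∘ sym)) ⟨
      δ (v i) (v k) + (δ b (v k) + deg (graph p es) (v k))   ≡⟨ deg-∷ (v i) b es (v k) ⟨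
      deg (graph p ((v i , b) ∷ es)) (v k)                   ∎
      where open ≡-Reasoning

    deg-swap : ∀ a b es u → deg (graph p ((a , b) ∷ es)) u ≡ deg (graph p ((b , a) ∷ es)) u
    deg-swap a b es u = begin
      deg (graph p ((a , b) ∷ es)) u             ≡⟨ deg-∷ a b es u ⟩
      δ a u + (δ b u + deg (graph p es) u)       ≡⟨ x∙yz≈y∙xz (δ a u) (δ b u) _ ⟩
      δ b u + (δ a u + deg (graph p es) u)       ≡⟨ deg-∷ b a es u ⟨
      deg (graph p ((b , a) ∷ es)) u             ∎
      where open ≡-Reasoning

    -- Loops are included as `i ≡ j`. Injectivity of `v` lets the tail `j` count as the end `v j`.
    -- The edge directed the other way is obtained by exchanging `i` and `j` and applying
    -- `deg-swap`.
    inner-edge : ∀ i j es (φ : Labels es) {m} (xs : Vec (Fin n) m) →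
      (∀ k → fibre φ (v k) + Vec.count (k ≟_) xs ≡ deg (graph p es) (v k)) →
      ∀ k → fibre (just (v i) ∷ φ) (v k) + Vec.count (k ≟_) (j ∷ xs) ≡ deg (graph p ((v i , v j) ∷ es)) (v k)
    inner-edge i j es φ xs h k = begin
      fibre (just (v i) ∷ φ) (v k) + Vec.count (k ≟_) (j ∷ xs)
        ≡⟨ cong₂ _+_ (fibre-just (v i) φ (v k)) (count-∷ k j xs) ⟩
      (δ (v i) (v k) + F) + (δ j k + o)                      ≡⟨ +-assoc (δ (v i) (v k)) F _ ⟩
      δ (v i) (v k) + (F + (δ j k + o))
        ≡⟨ cong (δ (v i) (v k) +_) (x∙yz≈y∙xz F (δ j k) o) ⟩
      δ (v i) (v k) + (δ j k + (F + o))
        ≡⟨ cong₂ (λ x y → δ (v i) (v k) + (x + y)) (sym (δ-injective injective j k)) (h k) ⟩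
      δ (v i) (v k) + (δ (v j) (v k) + deg (graph p es) (v k)) ≡⟨ deg-∷ (v i) (v j) es (v k) ⟨
      deg (graph p ((v i , v j) ∷ es)) (v k)                 ∎
      where
      open ≡-Reasoning
      F = fibre φ (v k)
      o = Vec.count (k ≟_) xs

    -- Each edge of the induced subgraph gets as its tail the end that is not its label.
    labeling⇒orientation : ∀ es φ → AllAllowed es φ → Avoids φ → height φ ≡ liveEdges es →
                           ∃ (Complementary es φ)
    labeling⇒orientation [] [] _ _ _ = [] , λ _ → refl
    labeling⇒orientation ((a , b) ∷ es) (nothing ∷ φ) ok off full
      with position v a | position-view a | position v b | position-view b
    ... | nothing | miss ma | nothing | miss mb =
      let O , h = labeling⇒orientation es φ (ok ∘ suc) off full
      in O , dead-edge es {fibre φ ∘ v} ma mb h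
    -- Full height leaves no live edge at ∞: the remaining edges can contribute at most
    -- `liveEdges es`, which is one too few.
    ... | just _  | _ | _      | _ =
      contradiction (≤-trans (≤-reflexive (sym full)) (height≤liveEdges es φ (ok ∘ suc) off)) 1+n≰n
    ... | nothing | _ | just _ | _ =
      contradiction (≤-trans (≤-reflexive (sym full)) (height≤liveEdges es φ (ok ∘ suc) off)) 1+n≰n
    labeling⇒orientation ((a , b) ∷ es) (just c ∷ φ) ok off full
      with position v a | position-view a | position v b | position-view b | ok zero
    ... | nothing | miss m  | nothing | miss _  | inj₁ refl        = contradiction m (avoids-head φ off)
    ... | nothing | miss _  | nothing | miss m  | inj₂ (inj₁ refl) = contradiction m (avoids-head φ off)
    ... | nothing | miss m  | just _  | hit _   | inj₁ refl        = contradiction m (avoids-head φ off)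
    ... | just _  | hit _   | nothing | miss m  | inj₂ (inj₁ refl) = contradiction m (avoids-head φ off)
    ... | just i  | hit .i  | nothing | miss mb | inj₁ refl =
      let O , h = labeling⇒orientation es φ (ok ∘ suc) (avoids-tail c φ off) (cong ℕ.pred full)
      in O , boundary-edge i es φ mb h
    ... | nothing | miss ma | just j  | hit .j  | inj₂ (inj₁ refl) =
      let O , h = labeling⇒orientation es φ (ok ∘ suc) (avoids-tail c φ off) (cong ℕ.pred full)
      in O , λ k → trans (boundary-edge j es φ ma h k) (deg-swap (v j) a es (v k))
    ... | just i  | hit .i  | just j  | hit .j  | inj₁ refl =
      let O , h = labeling⇒orientation es φ (ok ∘ suc) (avoids-tail c φ off) (cong ℕ.pred full)
      in false ∷ O , inner-edge i j es φ (tails (H es) O) h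
    ... | just i  | hit .i  | just j  | hit .j  | inj₂ (inj₁ refl) =
      let O , h = labeling⇒orientation es φ (ok ∘ suc) (avoids-tail c φ off) (cong ℕ.pred full)
      in true ∷ O , λ k → trans (inner-edge j i es φ (tails (H es) O) h k) (deg-swap (v j) (v i) es (v k))

    -- An arc is labeled by its head, an edge with one end in the range of `v` by that end, any
    -- other edge by ∞. `O` is bound only after both positions are known, since its length computes
    -- only then.
    orientation⇒labeling : ∀ es (O : Orientation (H es)) →
      ∃ λ φ → AllAllowed es φ × Avoids φ × height φ ≡ liveEdges es × Complementary es φ O
    orientation⇒labeling [] [] = [] , (λ ()) , (λ _ _ → refl) , refl , λ _ → refl
    orientation⇒labeling ((a , b) ∷ es)
      with position v a | position-view a | position v b | position-view b
    ... | nothing | miss ma | nothing | miss mb = λ O →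
      let φ , allowed , avoids , full , h = orientation⇒labeling es O
      in nothing ∷ φ , (λ { zero → inj₂ (inj₂ refl) ; (suc e) → allowed e }) , avoids , full ,
         dead-edge es {fibre φ ∘ v} ma mb h
    ... | just i | hit .i | nothing | miss mb = λ O →
      let φ , allowed , avoids , full , h = orientation⇒labeling es O
      in just (v i) ∷ φ , (λ { zero → inj₁ refl ; (suc e) → allowed e }) ,
         avoids-∷ i φ avoids , cong suc full ,
         boundary-edge i es φ mb h
    ... | nothing | miss ma | just j | hit .j = λ O →
      let φ , allowed , avoids , full , h = orientation⇒labeling es O
      in just (v j) ∷ φ , (λ { zero → inj₂ (inj₁ refl) ; (suc e) → allowed e }) ,
         avoids-∷ j φ avoids , cong suc full ,
         λ k → trans (boundary-edge j es φ ma h k) (deg-swap (v j) a es (v k))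
    ... | just i | hit .i | just j | hit .j = λ where
      (false ∷ O) →
        let φ , allowed , avoids , full , h = orientation⇒labeling es O
        in just (v i) ∷ φ , (λ { zero → inj₁ refl ; (suc e) → allowed e }) ,
           avoids-∷ i φ avoids , cong suc full ,
           inner-edge i j es φ (tails (H es) O) h
      (true ∷ O) →
        let φ , allowed , avoids , full , h = orientation⇒labeling es O
        in just (v j) ∷ φ , (λ { zero → inj₂ (inj₁ refl) ; (suc e) → allowed e }) ,
           avoids-∷ j φ avoids , cong suc full ,
           λ k → trans (inner-edge j i es φ (tails (H es) O) h k) (deg-swap (v j) (v i) es (v k))

-- The multiplicities of the full set of pairs are the degrees

♯-concatMap-tabulate : ∀ {A B : Set} {P : B → Set} (P? : Decidable P) (F : A → List B) {m} (g : Fin m → A) →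
                       ♯ P? (concatMap F (tabulate g)) ≡ ∑ (λ k → ♯ P? (F (g k)))
♯-concatMap-tabulate P? F {zero}  g = refl
♯-concatMap-tabulate P? F {suc m} g = trans (♯-++ P? (F (g zero)) _)
  (cong (♯ P? (F (g zero)) +_) (♯-concatMap-tabulate P? F (g ∘ suc)))

∑-δ-* : ∀ {n} (f : Fin n → ℕ) j → ∑ (λ i → δ i j * f i) ≡ f j
∑-δ-* {suc n} f zero    = trans (cong₂ _+_ (*-identityˡ (f zero)) (sum-replicate-zero n)) (+-identityʳ _)
∑-δ-* {suc n} f (suc j) = ∑-δ-* (f ∘ suc) j

module _ {p : ℕ} where

  at? : ∀ u → Decidable {A = Fin p × ℕ} (λ x → proj₁ x ≡ u)
  at? u x = proj₁ x ≟ u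

  mult-lookup : ∀ (xs : List (Fin p × ℕ)) u → mult (proj₁ ∘ List.lookup xs) ⊤ u ≡ ♯ (at? u) xs
  mult-lookup []       u = refl
  mult-lookup (x ∷ xs) u = trans (mult-inside (proj₁ ∘ List.lookup (x ∷ xs)) ⊤ u)
    (trans (cong (δ (proj₁ x) u +_) (mult-lookup xs u)) (sym (♯-∷ (at? u) x xs)))

  ♯-applyUpTo : ∀ u w (g : ℕ → ℕ) d → ♯ (at? u) (applyUpTo (λ i → w , g i) d) ≡ δ w u * d
  ♯-applyUpTo u w g zero    = sym (*-zeroʳ (δ w u))
  ♯-applyUpTo u w g (suc d) = trans (♯-∷ (at? u) (w , g 0) (applyUpTo (λ i → w , g (suc i)) d))
    (trans (cong (δ w u +_) (♯-applyUpTo u w (g ∘ suc) d)) (sym (*-suc (δ w u) d)))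

-- Each vertex `w` has its own block of `deg G w` pairs in `S G`, and only the block of `u`
-- contributes.
mult-⊤ : ∀ G u → mult (vertexOf G) ⊤ u ≡ deg G u
mult-⊤ G u = begin
  mult (vertexOf G) ⊤ u                     ≡⟨ mult-lookup (S G) u ⟩
  ♯ (at? u) (S G)
    ≡⟨ ♯-concatMap-tabulate (at? u) (λ w → applyUpTo (λ i → w , suc i) (deg G w)) id ⟩
  ∑ (λ w → ♯ (at? u) (applyUpTo (λ i → w , suc i) (deg G w)))
    ≡⟨ sum-cong-≗ (λ w → ♯-applyUpTo u w suc (deg G w)) ⟩
  ∑ (λ w → δ w u * deg G w)                 ≡⟨ ∑-δ-* (deg G) u ⟩
  deg G u                                   ∎
  where open ≡-Reasoning

-- Bases after deletion and out-degree vectors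

x∈p─q⇒x∉q : ∀ {n} {x : Fin n} (p q : Subset n) → x ∈ p ─ q → x ∉ q
x∈p─q⇒x∉q (_ ∷ p) (inside ∷ q) () here
x∈p─q⇒x∉q (_ ∷ p) (_ ∷ q) (there x∈) (there x∈q) = x∈p─q⇒x∉q p q x∈ x∈q

module _ {p N : ℕ} (f : Fin N → Fin p) where

  mult-zero : ∀ {X} u → (∀ {k} → k ∈ X → f k ≢ u) → mult f X u ≡ 0
  mult-zero {X} u none = n≤0⇒n≡0 (begin
    mult f X u  ≤⟨ mult-mono f {X} {∅} u (λ eq k∈ → contradiction eq (none k∈)) ⟩
    mult f ∅ u  ≤⟨ ∣p∩q∣≤∣p∣ ∅ (Vec.tabulate λ k → does (f k ≟ u)) ⟩
    ∣ ∅ {N} ∣   ≡⟨ ∣⊥∣≡0 N ⟩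
    0           ∎)
    where open ≤-Reasoning

module Bases (G : Graph) (W : Subset (Graph.order G)) {n : ℕ} (v : Fin n → Vertex G)
             (injective : Injective _≡_ _≡_ v) (W-complement : ∀ u → u ∉ W ⇔ (∃ λ i → v i ≡ u)) where

  open Orienting v injective using
    (Avoids; liveEdges; height≤liveEdges; labeling⇒orientation; orientation⇒labeling)

  f : Fin (length (S G)) → Vertex G
  f = vertexOf G

  es : List (Vertex G × Vertex G)
  es = Graph.edges G

  open Matroid TM[ G , W ]

  H : Graph
  H = induced G v

  FitsOutDegrees : Vec ℕ n → Subset (length (S G)) → Set
  FitsOutDegrees a = Fits W v injective W-complement f (lookup a)

  fitsOutDegrees? : ∀ a → Decidable (FitsOutDegrees a)
  fitsOutDegrees? a = fits? W v injective W-complement f (lookup a)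

  missed⇒∈W : ∀ {u} → (∀ i → v i ≢ u) → u ∈ W
  missed⇒∈W {u} missed with u ∈? W
  ... | yes u∈W = u∈W
  ... | no u∉W  = let i , vi≡u = Equivalence.to (W-complement u) u∉W in contradiction vi≡u (missed i)

  ∈ground⇒∉W : ∀ {k} → k ∈ ground → f k ∉ W
  ∈ground⇒∉W {k} k∈ fk∈W = x∈p─q⇒x∉q ⊤ (S[ G ] W) k∈
    (lookup⇒[]= k _ (trans (lookup∘tabulate _ k) ([]=⇒lookup fk∈W)))

  ∉W⇒∈ground : ∀ {k} → f k ∉ W → k ∈ ground
  ∉W⇒∈ground {k} fk∉W = x∈p∧x∉q⇒x∈p─q ∈⊤
    λ k∈ → fk∉W (lookup⇒[]= (f k) W (trans (sym (lookup∘tabulate _ k)) ([]=⇒lookup k∈)))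

  mult-W : ∀ {X} → X ⊆ ground → ∀ u → u ∈ W → mult f X u ≡ 0
  mult-W X⊆ u u∈W = mult-zero f u λ { k∈ refl → ∈ground⇒∉W (X⊆ k∈) u∈W }

  avoids : ∀ {X} (φ : Labels es) → X ⊆ ground → (∀ u → fibre φ u ≤ mult f X u) → Avoids φ
  avoids {X} φ X⊆ φ≤ u missed = n≤0⇒n≡0 (≤-trans (φ≤ u) (≤-reflexive (mult-W X⊆ u (missed⇒∈W missed))))

  rank≤liveEdges : ∀ {X} → X ⊆ ground → rank X ≤ liveEdges es
  rank≤liveEdges {X} X⊆ with maxHeight-attained es (mult f X)
  ... | φ , (allowed , φ≤) , eq = ≤-trans (≤-reflexive eq)
    (height≤liveEdges es φ allowed (avoids {X} φ X⊆ φ≤))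

  fibre≤mult : ∀ {X} (φ : Labels es) → Avoids φ → (∀ i → fibre φ (v i) ≤ mult f X (v i)) →
               ∀ u → fibre φ u ≤ mult f X u
  fibre≤mult φ off φ≤ u with any? (λ i → v i ≟ u)
  ... | yes (i , refl) = φ≤ i
  ... | no none        = ≤-trans (≤-reflexive (off u λ i vi≡u → none (i , vi≡u))) z≤n

  -- Any orientation will do, here the one following the listed order of the ends. Its labeling has
  -- full height, and its fibres are at most the degrees, all of which remain available outside `W`.
  rank-ground : rank ground ≡ liveEdges es
  rank-ground with orientation⇒labeling es (Vec.replicate _ true)
  ... | φ , allowed , off , full , complementary = ≤-antisym (rank≤liveEdges ⊆-refl)
    (≤-trans (≤-reflexive (sym full)) (maxHeight-upper es (mult f ground) φ
      (allowed , fibre≤mult {ground} φ off λ i → begin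
        fibre φ (v i)       ≤⟨ m≤m+n _ _ ⟩
        _                   ≡⟨ complementary i ⟩
        deg G (v i)         ≡⟨ mult-⊤ G (v i) ⟨
        mult f ⊤ (v i)      ≤⟨ mult-mono f {⊤} {ground} (v i) (λ eq _ → ∉W⇒∈ground
                                 (subst (_∉ W) (sym eq) (v∉W W v injective W-complement i))) ⟩
        mult f ground (v i) ∎)))
    where open ≤-Reasoning

  lookup-outDegrees : ∀ O i → lookup (outDegrees H O) i ≡ outDegree H O i
  lookup-outDegrees O i = lookup∘tabulate _ i

  basis⇒fits : ∀ {X} → IsBasis X → Any (λ a → FitsOutDegrees a X) (D⁺ H)
  basis⇒fits {X} basis@((X⊆ , ind) , _) with maxHeight-attained es (mult f X)
  ... | φ , (allowed , φ≤) , rank≡height = lose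
    (∈-deduplicate⁺ (Vec.≡-dec ℕ._≟_) (∈-map⁺ (outDegrees H) (∈-words bool∈ O)))
    (mult-W X⊆ , λ i → begin
      mult f X (v i) + lookup (outDegrees H O) i
        ≡⟨ cong₂ _+_ (sym (fibre≡mult (v i))) (lookup-outDegrees O i) ⟩
      fibre φ (v i) + outDegree H O i            ≡⟨ proj₂ oriented i ⟩
      deg G (v i)                                ≡⟨ mult-⊤ G (v i) ⟨
      mult f ⊤ (v i)                             ∎)
    where
    open ≡-Reasoning
    rank≡live : rank X ≡ liveEdges es
    rank≡live = trans (basis-rank TM[ G , W ] basis) rank-ground
    -- Independence makes the height of the optimal labeling equal to the size of `X`, so none of
    -- the bounds `φ≤` can be strict.
    fibre≡mult : ∀ u → fibre φ u ≡ mult f X u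
    fibre≡mult = ∑-tight φ≤ (≤-reflexive (begin
      ∑ (mult f X)  ≡⟨ ∑-mult f X ⟩
      ∣ X ∣         ≡⟨ ind ⟨
      rank X        ≡⟨ rank≡height ⟩
      height φ      ≡⟨ ∑-fibre φ ⟨
      ∑ (fibre φ)   ∎))
    oriented = labeling⇒orientation es φ allowed (avoids {X} φ X⊆ φ≤) (trans (sym rank≡height) rank≡live)
    O : Orientation H
    O = proj₁ oriented
    bool∈ : ∀ b → b ∈ₗ (true ∷ false ∷ [])
    bool∈ true  = here refl
    bool∈ false = there (here refl)

  -- The labeling built from the orientation has the multiplicities of `X` as its fibres. Its height
  -- is then both the size of `X` and the rank of the ground set, which gives independence and full
  -- rank together.
  fits⇒basis : ∀ {X} → Any (λ a → FitsOutDegrees a X) (D⁺ H) → IsBasis X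
  fits⇒basis {X} any with find any
  ... | a , a∈ , mult-W≡0 , fits with ∈-map⁻ (outDegrees H) (∈-deduplicate⁻ (Vec.≡-dec ℕ._≟_) _ a∈)
  ...   | O , _ , refl with orientation⇒labeling es O
  ...     | φ , allowed , off , full , complementary =
    independent⇒basis TM[ G , W ] ((λ {_} → X⊆) , trans rank≡live (sym size))
      (trans rank≡live (sym rank-ground))
    where
    X⊆ : X ⊆ ground
    X⊆ k∈ = ∉W⇒∈ground λ fk∈W → >⇒≢ (mult-positive f k∈) (mult-W≡0 _ fk∈W)
    fibre≡mult-v : ∀ i → fibre φ (v i) ≡ mult f X (v i)
    fibre≡mult-v i = +-cancelʳ-≡ (outDegree H O i) _ _ (begin
      fibre φ (v i) + outDegree H O i            ≡⟨ complementary i ⟩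
      deg G (v i)                                ≡⟨ mult-⊤ G (v i) ⟨
      mult f ⊤ (v i)                             ≡⟨ fits i ⟨
      mult f X (v i) + lookup (outDegrees H O) i ≡⟨ cong (mult f X (v i) +_) (lookup-outDegrees O i) ⟩
      mult f X (v i) + outDegree H O i           ∎)
      where open ≡-Reasoning
    fibre≡mult : ∀ u → fibre φ u ≡ mult f X u
    fibre≡mult u with any? (λ i → v i ≟ u)
    ... | yes (i , refl) = fibre≡mult-v i
    ... | no none = trans (off u missed) (sym (mult-W≡0 u (missed⇒∈W missed)))
      where
      missed : ∀ i → v i ≢ u
      missed i vi≡u = none (i , vi≡u)
    size : ∣ X ∣ ≡ liveEdges es
    size = begin
      ∣ X ∣         ≡⟨ ∑-mult f X ⟨
      ∑ (mult f X)  ≡⟨ sum-cong-≗ fibre≡mult ⟨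
      ∑ (fibre φ)   ≡⟨ ∑-fibre φ ⟩
      height φ      ≡⟨ full ⟩
      liveEdges es  ∎
      where open ≡-Reasoning
    rank≡live : rank X ≡ liveEdges es
    rank≡live = ≤-antisym (rank≤liveEdges X⊆) (≤-trans (≤-reflexive (sym full))
      (maxHeight-upper es (mult f X) φ (allowed , λ u → ≤-reflexive (fibre≡mult u))))

  -- Cancelling `mult f X (v i)` recovers `a` from `X`, so no basis is counted under two vectors.
  fits-functional : ∀ {a b X} → FitsOutDegrees a X → FitsOutDegrees b X → a ≡ b
  fits-functional {a} {b} {X} (_ , fa) (_ , fb) = begin
    a                         ≡⟨ tabulate∘lookup a ⟨
    Vec.tabulate (lookup a)   ≡⟨ Vec.tabulate-cong (λ i →
                                   +-cancelˡ-≡ (mult f X (v i)) _ _ (trans (fa i) (sym (fb i)))) ⟩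
    Vec.tabulate (lookup b)   ≡⟨ tabulate∘lookup b ⟩
    b                         ∎
    where open ≡-Reasoning

theorem1p3 : (G : Graph) (W : Subset (Graph.order G))
    {n : ℕ} (v : Fin n → Vertex G) →
    Injective _≡_ _≡_ v →
    (∀ u → u ∉ W ⇔ (∃ λ i → v i ≡ u)) →
    Matroid.numberOfBases TM[ G , W ] ≡
    sum (map (λ a → product (tabulate λ i → deg G (v i) C lookup a i)) (D⁺ (induced G v)))
theorem1p3 G W v injective W-complement = begin
  ♯ (Matroid.isBasis? TM[ G , W ]) (subsets N)
    ≡⟨ ♯-cong _ (λ X → Any.any? (λ a → fitsOutDegrees? a X) (D⁺ H)) (basis⇒fits , fits⇒basis) (subsets N) ⟩
  ♯ (λ X → Any.any? (λ a → fitsOutDegrees? a X) (D⁺ H)) (subsets N)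
    ≡⟨ ♯-Any fitsOutDegrees? (λ {a} {b} {X} → fits-functional {a} {b} {X})
         (deduplicate-! (Vec.≡-dec ℕ._≟_) _) (subsets N) ⟩
  sum (map (λ a → ♯ (fitsOutDegrees? a) (subsets N)) (D⁺ H))
    ≡⟨ cong sum (map-cong (λ a → trans (♯-fits W v injective W-complement f (lookup a))
         (∏-cong λ i → cong (_C lookup a i) (mult-⊤ G (v i)))) (D⁺ H)) ⟩
  sum (map (λ a → ∏ (λ i → deg G (v i) C lookup a i)) (D⁺ H)) ∎
  where
  open ≡-Reasoning
  open Bases G W v injective W-complement
  N = length (S G)
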